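{- Let $K$ be a commutative $\mathbb Q$-algebra, $n\ge1$, and let $F=X-H$ be a polynomial map over $K$ in $n$ variables, where $H=(H_1,\ldots,H_n)$ is homogeneous of degree $d\ge 2$, the Jacobian matrix $JH$ is symmetric, and $(JH)^3=0$. Then $F$ is invertible, with $$F^{ -1}=X+N^{(1)}+N^{(2)}.$$ In particular, the degree of $F^{ -1}$ is $\le 2d-1$ (independent of $n$).
   Context: $X=(X_1,\ldots,X_n)$, and $JH=(D_iH_j)$ with $D_i=\partial/\partial X_i$. "$H$ homogeneous of degree $d$" means each $H_i\in K[X_1,\ldots,X_n]$ is homogeneous of degree $d$ (possibly zero). "Invertible" means that $F$ has an inverse under composition which is a polynomial map over $K$. Such an $F=X-H$ always has a unique formal inverse $G$ (a system of power series $G_i=X_i+\text{higher degree terms}$ with $F\circ G=G\circ F=X$), and it has the form $G=X+N^{(1)}+N^{(2)}+N^{(3)}+\cdots$ with $N^{(m)}$ (an $n$-tuple) homogeneous of degree $m(d-1)+1$; this defines the $N^{(m)}$. -}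

module Defs where

open import Level using (Level; _⊔_)
open import Algebra.Bundles using (CommutativeRing; RawSemiring)
open import Algebra.Morphism.Structures using (IsRingHomomorphism)
import Algebra.Definitions.RawMonoid as RawMonoidDefinitions
import Algebra.Definitions.RawSemiring as RawSemiringDefinitions
open import Data.Bool.Base using (if_then_else_)
open import Data.Fin.Base using (Fin; zero; suc; toℕ)
open import Data.Nat.Base as ℕ using (ℕ; zero; suc; _<_; _≤_; _∸_)
import Data.Nat.Properties as ℕ
open import Data.Product.Base using (_×_)
open import Data.Rational.Base as ℚ using (ℚ)
open import Data.Vec.Base as Vec using (Vec; []; _∷_; replicate; zipWith; lookup; _[_]≔_; _[_]%=_)
open import Data.Vec.Properties using (≡-dec)
open import Relation.Binary.PropositionalEquality using (_≡_; _≢_; refl; cong; subst; ≢-sym)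
open import Relation.Nullary using (does; yes; no; contradiction)
open import Relation.Nullary.Decidable using (dec-false)

record ℚ-Algebra {c ℓ : Level} (K : CommutativeRing c ℓ) : Set (c ⊔ ℓ) where
  open CommutativeRing K using (Carrier; rawRing)
  field
    fromℚ              : ℚ → Carrier
    isRingHomomorphism : IsRingHomomorphism ℚ.+-*-rawRing rawRing fromℚ

-- The exponent vector α stands for the monomial X₁^α₁ ⋯ Xₙ^αₙ.
Exponent : ℕ → Set
Exponent = Vec ℕ

degree : ∀ {n} → Exponent n → ℕ
degree = Vec.sum

unit : ∀ {n} → Fin n → Exponent n
unit {n} i = replicate n 0 [ i ]≔ 1

degree-zero : ∀ n → degree (replicate n 0) ≡ 0
degree-zero zero    = refl
degree-zero (suc n) = degree-zero n

degree-unit : ∀ {n} (i : Fin n) → degree (unit i) ≡ 1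
degree-unit {suc n} zero    = cong suc (degree-zero n)
degree-unit {suc n} (suc i) = degree-unit i

module PolynomialMaps {c ℓ : Level} (K : CommutativeRing c ℓ) where

  open CommutativeRing K
    using (Carrier; 0#; 1#)
    renaming (_≈_ to _≈ᴷ_; _+_ to _+ᴷ_; _*_ to _*ᴷ_; _-_ to _-ᴷ_)
  private module K = CommutativeRing K
  open RawMonoidDefinitions K.+-rawMonoid using () renaming (sum to sumᴷ; _×_ to _·ᴷ_)
  open import Algebra.Properties.Ring K.ring using (-0#≈0#)

  -- Σ□ α f is the sum of f β over all β with βᵢ ≤ αᵢ for every i.
  Σ□ : ∀ {n} → Exponent n → (Exponent n → Carrier) → Carrier
  Σ□ []      f = f []
  Σ□ (a ∷ α) f = sumᴷ {suc a} λ i → Σ□ α λ β → f (toℕ i ∷ β)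

  -- A formal power series is the family of its coefficients.
  Series : ℕ → Set c
  Series n = Exponent n → Carrier

  series-rawSemiring : ℕ → RawSemiring c ℓ
  series-rawSemiring n = record
    { Carrier = Series n
    ; _≈_     = λ f g → ∀ α → f α ≈ᴷ g α
    ; _+_     = λ f g α → f α +ᴷ g α
    ; _*_     = λ f g α → Σ□ α λ β → f β *ᴷ g (zipWith _∸_ α β)
    ; 0#      = λ _ → 0#
    ; 1#      = λ α → if does (≡-dec ℕ._≟_ α (replicate n 0)) then 1# else 0#
    }

  module _ {n : ℕ} where
    open RawSemiring (series-rawSemiring n) public using (_≈_; _+_; _*_)
    open RawSemiringDefinitions (series-rawSemiring n) public using (_^_; sum; product)

  ∂ : ∀ {n} → Fin n → Series n → Series n
  ∂ i f α = suc (lookup α i) ·ᴷ f (α [ i ]%= suc)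

  DegreeAtMost : ∀ {n} → ℕ → Series n → Set ℓ
  DegreeAtMost D f = ∀ α → D < degree α → f α ≈ᴷ 0#

  -- The field bound is only an upper bound for the degree; polynomials are
  -- compared through their coefficients, never through their bounds.
  record Polynomial (n : ℕ) : Set (c ⊔ ℓ) where
    field
      coeff   : Series n
      bound   : ℕ
      bounded : DegreeAtMost bound coeff
  open Polynomial public

  -- The zero polynomial is homogeneous of every degree.
  Homogeneous : ∀ {n} → ℕ → Polynomial n → Set ℓ
  Homogeneous d f = ∀ α → degree α ≢ d → coeff f α ≈ᴷ 0#

  var : ∀ {n} → Fin n → Polynomial n
  var {n} i = record { coeff = X ; bound = 1 ; bounded = X-bounded }
    where
    X : Series n
    X α = if does (≡-dec ℕ._≟_ α (unit i)) then 1# else 0#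

    X-bounded : DegreeAtMost 1 X
    X-bounded α 1<α with ≡-dec ℕ._≟_ α (unit i)
    ... | yes refl = contradiction (subst (1 <_) (degree-unit i) 1<α) (ℕ.n≮n 1)
    ... | no _     = K.refl

  infixl 6 _⊞_ _⊟_

  _⊞_ : ∀ {n} → Polynomial n → Polynomial n → Polynomial n
  f ⊞ g = record
    { coeff   = λ α → coeff f α +ᴷ coeff g α
    ; bound   = bound f ℕ.⊔ bound g
    ; bounded = λ α b<α → K.trans
        (K.+-cong (bounded f α (ℕ.m⊔n<o⇒m<o (bound f) (bound g) b<α))
                  (bounded g α (ℕ.m⊔n<o⇒n<o (bound f) (bound g) b<α)))
        (K.+-identityʳ 0#)
    }

  _⊟_ : ∀ {n} → Polynomial n → Polynomial n → Polynomial n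
  f ⊟ g = record
    { coeff   = λ α → coeff f α -ᴷ coeff g α
    ; bound   = bound f ℕ.⊔ bound g
    ; bounded = λ α b<α → K.trans
        (K.+-cong (bounded f α (ℕ.m⊔n<o⇒m<o (bound f) (bound g) b<α))
                  (K.trans (K.-‿cong (bounded g α (ℕ.m⊔n<o⇒n<o (bound f) (bound g) b<α)))
                           -0#≈0#))
        (K.+-identityʳ 0#)
    }

  component : ∀ {n} → ℕ → Series n → Polynomial n
  component {n} k f = record { coeff = fₖ ; bound = k ; bounded = fₖ-bounded }
    where
    fₖ : Series n
    fₖ α = if does (degree α ℕ.≟ k) then f α else 0#

    fₖ-bounded : DegreeAtMost k fₖ
    fₖ-bounded α k<α = K.reflexive (cong (if_then f α else 0#)
      (dec-false (degree α ℕ.≟ k) (≢-sym (ℕ.<⇒≢ k<α))))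

  SeriesMap : ℕ → Set c
  SeriesMap n = Fin n → Series n

  PolyMap : ℕ → Set (c ⊔ ℓ)
  PolyMap n = Fin n → Polynomial n

  X : ∀ {n} → PolyMap n
  X = var

  series : ∀ {n} → PolyMap n → SeriesMap n
  series F i = coeff (F i)

  infix 4 _≋_
  _≋_ : ∀ {n} → SeriesMap n → SeriesMap n → Set ℓ
  F ≋ G = ∀ i → F i ≈ G i

  -- The sum of f_α G^α over all α with every αᵢ ≤ D; in particular every α of
  -- degree at most D is included.
  substituteUpTo : ∀ {n} → ℕ → Series n → SeriesMap n → Series n
  substituteUpTo {n} D f G γ =
    Σ□ (replicate n D) λ α → f α *ᴷ product (λ i → G i ^ lookup α i) γ

  infixl 9 _∘ᴾ_ _∘ᶠ_

  _∘ᴾ_ : ∀ {n} → PolyMap n → SeriesMap n → SeriesMap n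
  (F ∘ᴾ G) i = substituteUpTo (bound (F i)) (coeff (F i)) G

  -- Composition of formal power series.  It is meaningful only when every Gⱼ
  -- has zero constant term: then G^α has no terms of degree below that of α,
  -- so only finitely many α contribute to the coefficient at γ.
  _∘ᶠ_ : ∀ {n} → SeriesMap n → SeriesMap n → SeriesMap n
  (F ∘ᶠ G) i γ = substituteUpTo (degree γ) (F i) G γ

  IsInverse : ∀ {n} → PolyMap n → PolyMap n → Set ℓ
  IsInverse F G = F ∘ᴾ series G ≋ series X × G ∘ᴾ series F ≋ series X

  -- Intended for F of the form X + (terms of degree ≥ 2), so that F has no
  -- constant term and G ∘ᶠ F is meaningful.
  record IsFormalInverse {n} (F : PolyMap n) (G : SeriesMap n) : Set ℓ where
    field
      leading : ∀ i α → degree α ≤ 1 → G i α ≈ᴷ series X i α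
      F∘G≋X   : F ∘ᴾ G ≋ series X
      G∘F≋X   : G ∘ᶠ series F ≋ series X

  Matrix : ℕ → Set c
  Matrix n = Fin n → Fin n → Series n

  infixl 7 _⊗_
  _⊗_ : ∀ {n} → Matrix n → Matrix n → Matrix n
  (A ⊗ B) i j = sum λ k → A i k * B k j

  Symmetric : ∀ {n} → Matrix n → Set ℓ
  Symmetric A = ∀ i j → A i j ≈ A j i

  IsZero : ∀ {n} → Matrix n → Set ℓ
  IsZero A = ∀ i j α → A i j α ≈ᴷ 0#

  J : ∀ {n} → PolyMap n → Matrix n
  J H i j = ∂ i (coeff (H j))

  -- N⁽ᵐ⁾, read off the formal inverse G of X - H with H homogeneous of degree d.
  N : ∀ {n} → ℕ → SeriesMap n → ℕ → PolyMap n
  N d G m i = component (m ℕ.* (d ∸ 1) ℕ.+ 1) (G i)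

-- Put b = (JH) H, so that N⁽¹⁾ = H and N⁽²⁾ = b.  By Euler's identity H is a
-- multiple of (JH) X, so (JH)³ = 0 gives (JH) b = 0; since JH is symmetric, the
-- gradients of ⟨H , b⟩ = 0 and ⟨b , b⟩ = 0 then yield (Jb) H = 0 and (Jb) b = 0.
-- Hence for V = -H, W = X + H + b and for V = H + b, W = X - H the second
-- derivative of W along V (with the coefficients of V frozen) vanishes.  As JW
-- is symmetric, all higher ones vanish too, and Taylor's formula reduces to
-- W(X + V) = W + (JW) V = X, in both cases.

module Submission where

open import Defs
open import Algebra.Bundles using (CommutativeRing; Monoid; RawSemiring)
import Algebra.Definitions
open import Algebra.Morphism.Structures using (IsRingHomomorphism)
import Algebra.Properties.CommutativeMonoid.Mult as CommutativeMonoidMult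
import Algebra.Properties.CommutativeMonoid.Sum as CommutativeMonoidSum
import Algebra.Properties.CommutativeSemigroup as CommutativeSemigroupProperties
import Algebra.Properties.Group as GroupProperties
import Algebra.Properties.Monoid.Mult as MonoidMult
import Algebra.Properties.Ring as RingProperties
import Algebra.Properties.Semiring.Mult as SemiringMult
import Algebra.Properties.Semiring.Sum as SemiringSum
open import Algebra.Structures using (IsAbelianGroup)
open import Data.Bool.Base using (if_then_else_)
open import Data.Fin.Base using (Fin; zero; suc; toℕ)
import Data.Fin.Properties as Fin
open import Data.Nat.Base as ℕ using (ℕ; zero; suc; _≤_; _<_; _∸_; z≤n; s≤s)
import Data.Nat.Properties as ℕ
open import Data.Nat.Tactic.RingSolver using (solve-∀)
open import Data.Product.Base using (Σ-syntax; _×_; _,_)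
open import Data.Rational.Base as ℚ using (ℚ)
import Data.Rational.Properties as ℚ
open import Data.Vec.Base using ([]; _∷_; lookup; replicate; zipWith; _[_]%=_)
open import Data.Vec.Properties using (≡-dec)
open import Function.Base using (_∘_)
open import Level using (_⊔_)
open import Relation.Binary.PropositionalEquality as ≡ using (_≡_; _≢_)
import Relation.Binary.Reasoning.Setoid as SetoidReasoning
open import Relation.Nullary using (contradiction; yes; no)
open import Relation.Nullary.Decidable using (dec-true; dec-false)

-- The two choices of V are the displacements of the two substitutions: X - H is X + V for V = -H,
-- and X + H + b is X + V for V = H + b, so each choice yields one composite.
--
-- Taylor's formula takes the most work. Composition is defined through coefficients, as a sum of
-- monomials in the substituted series, so the formula is proved by building polynomials up from the
-- coordinates: Taylor sums are compatible with addition and with multiplication by a coordinate,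
-- and their partial sums are eventually constant.
--
-- Rational scalars enter three times: the degree is cancelled in Euler's identity, 2 in the
-- gradient of ⟨b , b⟩, and k! divides the Taylor terms.
--
-- The N⁽ᵐ⁾ belong to an arbitrary formal inverse, so comparing it with X + H + b requires
-- uniqueness of right inverses. As d ≥ 2, the degrees 1, d and 2d - 1 are distinct, and H and b can
-- be read off as N⁽¹⁾ and N⁽²⁾.

module _ {c ℓ} (M : Monoid c ℓ) where
  open Monoid M
  open MonoidMult M using () renaming (_×_ to _·_)

  ×-zeroʳ : ∀ k → k · ε ≈ ε
  ×-zeroʳ zero    = refl
  ×-zeroʳ (suc k) = trans (identityˡ _) (×-zeroʳ k)

-- Convolution of sequences over a commutative ring.

module Convolution {c ℓ} (R : CommutativeRing c ℓ) where

  open CommutativeRing R hiding (zero)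

  -- The product is abstract and known only through its recursion in the first factor. Every law
  -- below is then an induction on the index instead of a manipulation of double sums.
  module Laws
    (_⋆_ : (ℕ → Carrier) → (ℕ → Carrier) → ℕ → Carrier)
    (⋆-zero : ∀ f g → (f ⋆ g) 0 ≈ f 0 * g 0)
    (⋆-suc : ∀ f g a → (f ⋆ g) (suc a) ≈ f 0 * g (suc a) + ((f ∘ suc) ⋆ g) a)
    where

    open SetoidReasoning setoid
    open CommutativeSemigroupProperties +-commutativeSemigroup
      using (interchange; x∙yz≈y∙xz)
    open SemiringMult semiring using (×-homo-1; ×-congʳ; ×-comm-*) renaming (_×_ to _·_)

    open CommutativeMonoidMult +-commutativeMonoid using (×-distrib-+)

    private
      Sequence : Set c
      Sequence = ℕ → Carrier

      infix 4 _≗_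
      _≗_ : Sequence → Sequence → Set ℓ
      f ≗ g = ∀ a → f a ≈ g a

      infixl 6 _⊕_
      _⊕_ : Sequence → Sequence → Sequence
      (f ⊕ g) a = f a + g a

      infixr 7 _⊙_
      _⊙_ : Carrier → Sequence → Sequence
      (x ⊙ f) a = x * f a

    ⋆-cong : ∀ {f f′ g g′} → f ≗ f′ → g ≗ g′ → f ⋆ g ≗ f′ ⋆ g′
    ⋆-cong {f} {f′} {g} {g′} p q zero = begin
      (f ⋆ g) 0    ≈⟨ ⋆-zero f g ⟩
      f 0 * g 0    ≈⟨ *-cong (p 0) (q 0) ⟩
      f′ 0 * g′ 0  ≈⟨ ⋆-zero f′ g′ ⟨
      (f′ ⋆ g′) 0  ∎
    ⋆-cong {f} {f′} {g} {g′} p q (suc a) = begin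
      (f ⋆ g) (suc a)                              ≈⟨ ⋆-suc f g a ⟩
      f 0 * g (suc a) + ((f ∘ suc) ⋆ g) a
        ≈⟨ +-cong (*-cong (p 0) (q (suc a))) (⋆-cong (p ∘ suc) q a) ⟩
      f′ 0 * g′ (suc a) + ((f′ ∘ suc) ⋆ g′) a      ≈⟨ ⋆-suc f′ g′ a ⟨
      (f′ ⋆ g′) (suc a)                            ∎

    -- Mirror image of `⋆-suc`, peeling terms off the other end. Matching the two recursions is what
    -- makes commutativity a plain induction.
    ⋆-sucʳ : ∀ f g a → (f ⋆ g) (suc a) ≈ f (suc a) * g 0 + (f ⋆ (g ∘ suc)) a
    ⋆-sucʳ f g zero = begin
      (f ⋆ g) 1                              ≈⟨ ⋆-suc f g 0 ⟩
      f 0 * g 1 + ((f ∘ suc) ⋆ g) 0          ≈⟨ +-congˡ (⋆-zero (f ∘ suc) g) ⟩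
      f 0 * g 1 + f 1 * g 0                  ≈⟨ +-comm _ _ ⟩
      f 1 * g 0 + f 0 * g 1                  ≈⟨ +-congˡ (⋆-zero f (g ∘ suc)) ⟨
      f 1 * g 0 + (f ⋆ (g ∘ suc)) 0          ∎
    ⋆-sucʳ f g (suc a) = begin
      (f ⋆ g) (suc (suc a))                  ≈⟨ ⋆-suc f g (suc a) ⟩
      f 0 * g (suc (suc a)) + ((f ∘ suc) ⋆ g) (suc a)
        ≈⟨ +-congˡ (⋆-sucʳ (f ∘ suc) g a) ⟩
      f 0 * g (suc (suc a)) + (f (suc (suc a)) * g 0 + ((f ∘ suc) ⋆ (g ∘ suc)) a)
        ≈⟨ x∙yz≈y∙xz _ _ _ ⟩
      f (suc (suc a)) * g 0 + (f 0 * g (suc (suc a)) + ((f ∘ suc) ⋆ (g ∘ suc)) a)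
        ≈⟨ +-congˡ (⋆-suc f (g ∘ suc) a) ⟨
      f (suc (suc a)) * g 0 + (f ⋆ (g ∘ suc)) (suc a) ∎

    ⋆-comm : ∀ f g → f ⋆ g ≗ g ⋆ f
    ⋆-comm f g zero    = trans (⋆-zero f g) (trans (*-comm _ _) (sym (⋆-zero g f)))
    ⋆-comm f g (suc a) = begin
      (f ⋆ g) (suc a)                      ≈⟨ ⋆-suc f g a ⟩
      f 0 * g (suc a) + ((f ∘ suc) ⋆ g) a  ≈⟨ +-cong (*-comm _ _) (⋆-comm (f ∘ suc) g a) ⟩
      g (suc a) * f 0 + (g ⋆ (f ∘ suc)) a  ≈⟨ ⋆-sucʳ g f a ⟨
      (g ⋆ f) (suc a)                      ∎

    ⋆-distribˡ : ∀ f g h → f ⋆ (g ⊕ h) ≗ (f ⋆ g) ⊕ (f ⋆ h)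
    ⋆-distribˡ f g h zero = begin
      (f ⋆ (g ⊕ h)) 0          ≈⟨ ⋆-zero f (g ⊕ h) ⟩
      f 0 * (g 0 + h 0)        ≈⟨ distribˡ _ _ _ ⟩
      f 0 * g 0 + f 0 * h 0    ≈⟨ +-cong (⋆-zero f g) (⋆-zero f h) ⟨
      (f ⋆ g) 0 + (f ⋆ h) 0    ∎
    ⋆-distribˡ f g h (suc a) = begin
      (f ⋆ (g ⊕ h)) (suc a)
        ≈⟨ ⋆-suc f (g ⊕ h) a ⟩
      f 0 * (g (suc a) + h (suc a)) + ((f ∘ suc) ⋆ (g ⊕ h)) a
        ≈⟨ +-cong (distribˡ _ _ _) (⋆-distribˡ (f ∘ suc) g h a) ⟩
      f 0 * g (suc a) + f 0 * h (suc a) + (((f ∘ suc) ⋆ g) a + ((f ∘ suc) ⋆ h) a)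
        ≈⟨ interchange _ _ _ _ ⟩
      f 0 * g (suc a) + ((f ∘ suc) ⋆ g) a + (f 0 * h (suc a) + ((f ∘ suc) ⋆ h) a)
        ≈⟨ +-cong (⋆-suc f g a) (⋆-suc f h a) ⟨
      (f ⋆ g) (suc a) + (f ⋆ h) (suc a) ∎

    ⋆-distribʳ : ∀ f g h → (g ⊕ h) ⋆ f ≗ (g ⋆ f) ⊕ (h ⋆ f)
    ⋆-distribʳ f g h a = begin
      ((g ⊕ h) ⋆ f) a          ≈⟨ ⋆-comm (g ⊕ h) f a ⟩
      (f ⋆ (g ⊕ h)) a          ≈⟨ ⋆-distribˡ f g h a ⟩
      (f ⋆ g) a + (f ⋆ h) a    ≈⟨ +-cong (⋆-comm f g a) (⋆-comm f h a) ⟩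
      (g ⋆ f) a + (h ⋆ f) a    ∎

    ⊙-⋆ : ∀ x f g → (x ⊙ f) ⋆ g ≗ x ⊙ (f ⋆ g)
    ⊙-⋆ x f g zero = begin
      ((x ⊙ f) ⋆ g) 0    ≈⟨ ⋆-zero (x ⊙ f) g ⟩
      x * f 0 * g 0      ≈⟨ *-assoc _ _ _ ⟩
      x * (f 0 * g 0)    ≈⟨ *-congˡ (⋆-zero f g) ⟨
      x * (f ⋆ g) 0      ∎
    ⊙-⋆ x f g (suc a) = begin
      ((x ⊙ f) ⋆ g) (suc a)                              ≈⟨ ⋆-suc (x ⊙ f) g a ⟩
      x * f 0 * g (suc a) + ((x ⊙ (f ∘ suc)) ⋆ g) a      ≈⟨ +-cong (*-assoc _ _ _) (⊙-⋆ x (f ∘ suc) g a) ⟩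
      x * (f 0 * g (suc a)) + x * ((f ∘ suc) ⋆ g) a      ≈⟨ distribˡ _ _ _ ⟨
      x * (f 0 * g (suc a) + ((f ∘ suc) ⋆ g) a)          ≈⟨ *-congˡ (⋆-suc f g a) ⟨
      x * (f ⋆ g) (suc a)                                ∎

    ⋆-assoc : ∀ f g h → (f ⋆ g) ⋆ h ≗ f ⋆ (g ⋆ h)
    ⋆-assoc f g h zero = begin
      ((f ⋆ g) ⋆ h) 0      ≈⟨ ⋆-zero (f ⋆ g) h ⟩
      (f ⋆ g) 0 * h 0      ≈⟨ *-congʳ (⋆-zero f g) ⟩
      f 0 * g 0 * h 0      ≈⟨ *-assoc _ _ _ ⟩
      f 0 * (g 0 * h 0)    ≈⟨ *-congˡ (⋆-zero g h) ⟨
      f 0 * (g ⋆ h) 0      ≈⟨ ⋆-zero f (g ⋆ h) ⟨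
      (f ⋆ (g ⋆ h)) 0      ∎
    ⋆-assoc f g h (suc a) = begin
      ((f ⋆ g) ⋆ h) (suc a)
        ≈⟨ ⋆-suc (f ⋆ g) h a ⟩
      (f ⋆ g) 0 * h (suc a) + (((f ⋆ g) ∘ suc) ⋆ h) a
        ≈⟨ +-cong (*-congʳ (⋆-zero f g)) (⋆-cong (⋆-suc f g) (λ _ → refl) a) ⟩
      f 0 * g 0 * h (suc a) + (((f 0 ⊙ (g ∘ suc)) ⊕ ((f ∘ suc) ⋆ g)) ⋆ h) a
        ≈⟨ +-cong (*-assoc _ _ _) (⋆-distribʳ h (f 0 ⊙ (g ∘ suc)) ((f ∘ suc) ⋆ g) a) ⟩
      f 0 * (g 0 * h (suc a)) + (((f 0 ⊙ (g ∘ suc)) ⋆ h) a + (((f ∘ suc) ⋆ g) ⋆ h) a)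
        ≈⟨ +-assoc _ _ _ ⟨
      f 0 * (g 0 * h (suc a)) + ((f 0 ⊙ (g ∘ suc)) ⋆ h) a + (((f ∘ suc) ⋆ g) ⋆ h) a
        ≈⟨ +-cong (+-congˡ (⊙-⋆ (f 0) (g ∘ suc) h a)) (⋆-assoc (f ∘ suc) g h a) ⟩
      f 0 * (g 0 * h (suc a)) + f 0 * ((g ∘ suc) ⋆ h) a + ((f ∘ suc) ⋆ (g ⋆ h)) a
        ≈⟨ +-congʳ (distribˡ _ _ _) ⟨
      f 0 * (g 0 * h (suc a) + ((g ∘ suc) ⋆ h) a) + ((f ∘ suc) ⋆ (g ⋆ h)) a
        ≈⟨ +-congʳ (*-congˡ (⋆-suc g h a)) ⟨
      f 0 * (g ⋆ h) (suc a) + ((f ∘ suc) ⋆ (g ⋆ h)) a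
        ≈⟨ ⋆-suc f (g ⋆ h) a ⟨
      (f ⋆ (g ⋆ h)) (suc a) ∎

    ⋆-zeroˡ : ∀ f g → f ≗ (λ _ → 0#) → f ⋆ g ≗ λ _ → 0#
    ⋆-zeroˡ f g f≗0 zero    = trans (⋆-zero f g) (trans (*-congʳ (f≗0 0)) (zeroˡ _))
    ⋆-zeroˡ f g f≗0 (suc a) = begin
      (f ⋆ g) (suc a)                      ≈⟨ ⋆-suc f g a ⟩
      f 0 * g (suc a) + ((f ∘ suc) ⋆ g) a
        ≈⟨ +-cong (trans (*-congʳ (f≗0 0)) (zeroˡ _)) (⋆-zeroˡ (f ∘ suc) g (f≗0 ∘ suc) a) ⟩
      0# + 0#                              ≈⟨ +-identityʳ 0# ⟩
      0#                                   ∎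

    ⋆-constantˡ : ∀ f g → (∀ a → f (suc a) ≈ 0#) → f ⋆ g ≗ f 0 ⊙ g
    ⋆-constantˡ f g f≗0 zero    = ⋆-zero f g
    ⋆-constantˡ f g f≗0 (suc a) = trans (⋆-suc f g a)
      (trans (+-congˡ (⋆-zeroˡ (f ∘ suc) g f≗0 a)) (+-identityʳ _))

    derivative : Sequence → Sequence
    derivative f a = suc a · f (suc a)

    ⋆-leibniz : ∀ f g → derivative (f ⋆ g) ≗ (derivative f ⋆ g) ⊕ (f ⋆ derivative g)
    ⋆-leibniz f g zero = begin
      1 · (f ⋆ g) 1                                ≈⟨ ×-homo-1 _ ⟩
      (f ⋆ g) 1                                    ≈⟨ ⋆-suc f g 0 ⟩
      f 0 * g 1 + ((f ∘ suc) ⋆ g) 0                ≈⟨ +-congˡ (⋆-zero (f ∘ suc) g) ⟩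
      f 0 * g 1 + f 1 * g 0                        ≈⟨ +-comm _ _ ⟩
      f 1 * g 0 + f 0 * g 1                        ≈⟨ +-cong (*-congʳ (×-homo-1 _)) (*-congˡ (×-homo-1 _)) ⟨
      1 · f 1 * g 0 + f 0 * 1 · g 1
        ≈⟨ +-cong (⋆-zero (derivative f) g) (⋆-zero f (derivative g)) ⟨
      (derivative f ⋆ g) 0 + (f ⋆ derivative g) 0                    ∎
    ⋆-leibniz f g (suc a) = begin
      (f ⋆ g) (suc (suc a)) + suc a · (f ⋆ g) (suc (suc a))
        ≈⟨ +-cong (⋆-suc f g (suc a)) (×-congʳ (suc a) (⋆-suc f g (suc a))) ⟩
      (f 0 * g (suc (suc a)) + (f′ ⋆ g) (suc a)) + suc a · (f 0 * g (suc (suc a)) + (f′ ⋆ g) (suc a))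
        ≈⟨ +-congˡ (×-distrib-+ _ _ (suc a)) ⟩
      (f 0 * g (suc (suc a)) + (f′ ⋆ g) (suc a)) + (suc a · (f 0 * g (suc (suc a))) + derivative (f′ ⋆ g) a)
        ≈⟨ interchange _ _ _ _ ⟩
      suc (suc a) · (f 0 * g (suc (suc a))) + ((f′ ⋆ g) (suc a) + derivative (f′ ⋆ g) a)
        ≈⟨ +-cong (×-comm-* (suc (suc a)) _ _) (+-congˡ (sym (⋆-leibniz f′ g a))) ⟨
      f 0 * derivative g (suc a) + ((f′ ⋆ g) (suc a) + ((derivative f′ ⋆ g) a + (f′ ⋆ derivative g) a))
        ≈⟨ +-congˡ (+-assoc _ _ _) ⟨
      f 0 * derivative g (suc a) + ((f′ ⋆ g) (suc a) + (derivative f′ ⋆ g) a + (f′ ⋆ derivative g) a)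
        ≈⟨ x∙yz≈y∙xz _ _ _ ⟩
      (f′ ⋆ g) (suc a) + (derivative f′ ⋆ g) a + (f 0 * derivative g (suc a) + (f′ ⋆ derivative g) a)
        ≈⟨ +-congʳ (+-congʳ (⋆-suc f′ g a)) ⟩
      f 1 * g (suc a) + ((f′ ∘ suc) ⋆ g) a + (derivative f′ ⋆ g) a + (f 0 * derivative g (suc a) + (f′ ⋆ derivative g) a)
        ≈⟨ +-congʳ (+-assoc _ _ _) ⟩
      f 1 * g (suc a) + (((f′ ∘ suc) ⋆ g) a + (derivative f′ ⋆ g) a) + (f 0 * derivative g (suc a) + (f′ ⋆ derivative g) a)
        -- By definition `derivative f ∘ suc` is `(f′ ∘ suc) ⊕ derivative f′`: the single copy split
        -- off from the multiple a + 2 turns the derivative of the shifted sequence into the shifted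
        -- derivative.
        ≈⟨ +-cong (+-cong (*-congʳ (×-homo-1 _)) (⋆-distribʳ g (f′ ∘ suc) (derivative f′) a)) (⋆-suc f (derivative g) a) ⟨
      derivative f 0 * g (suc a) + ((derivative f ∘ suc) ⋆ g) a + (f ⋆ derivative g) (suc a)
        ≈⟨ +-congʳ (⋆-suc (derivative f) g a) ⟨
      (derivative f ⋆ g) (suc a) + (f ⋆ derivative g) (suc a) ∎
      where f′ = f ∘ suc

    module _ (δ : Carrier → Carrier)
      (δ-cong : ∀ {x y} → x ≈ y → δ x ≈ δ y)
      (δ-+ : ∀ x y → δ (x + y) ≈ δ x + δ y)
      (δ-* : ∀ x y → δ (x * y) ≈ δ x * y + x * δ y)
      where

      -- Serves the derivatives in the remaining variables, which act on each coefficient of the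
      -- sequence; `⋆-leibniz` serves the distinguished variable.
      ⋆-leibniz-coefficientwise : ∀ f g → δ ∘ (f ⋆ g) ≗ ((δ ∘ f) ⋆ g) ⊕ (f ⋆ (δ ∘ g))
      ⋆-leibniz-coefficientwise f g zero = begin
        δ ((f ⋆ g) 0)                               ≈⟨ δ-cong (⋆-zero f g) ⟩
        δ (f 0 * g 0)                               ≈⟨ δ-* _ _ ⟩
        δ (f 0) * g 0 + f 0 * δ (g 0)               ≈⟨ +-cong (⋆-zero (δ ∘ f) g) (⋆-zero f (δ ∘ g)) ⟨
        ((δ ∘ f) ⋆ g) 0 + (f ⋆ (δ ∘ g)) 0           ∎
      ⋆-leibniz-coefficientwise f g (suc a) = begin
        δ ((f ⋆ g) (suc a))
          ≈⟨ δ-cong (⋆-suc f g a) ⟩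
        δ (f 0 * g (suc a) + (f′ ⋆ g) a)
          ≈⟨ δ-+ _ _ ⟩
        δ (f 0 * g (suc a)) + δ ((f′ ⋆ g) a)
          ≈⟨ +-cong (δ-* _ _) (⋆-leibniz-coefficientwise f′ g a) ⟩
        δ (f 0) * g (suc a) + f 0 * δ (g (suc a)) + (((δ ∘ f′) ⋆ g) a + (f′ ⋆ (δ ∘ g)) a)
          ≈⟨ interchange _ _ _ _ ⟩
        δ (f 0) * g (suc a) + ((δ ∘ f′) ⋆ g) a + (f 0 * δ (g (suc a)) + (f′ ⋆ (δ ∘ g)) a)
          ≈⟨ +-cong (⋆-suc (δ ∘ f) g a) (⋆-suc f (δ ∘ g) a) ⟨
        ((δ ∘ f) ⋆ g) (suc a) + (f ⋆ (δ ∘ g)) (suc a) ∎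
        where f′ = f ∘ suc

-- The ring of power series in n variables and its partial derivatives.

module SeriesRing {c ℓ} (K : CommutativeRing c ℓ) where

  open PolynomialMaps K using (Series; series-rawSemiring; Σ□; ∂)
  open PolynomialMaps K using () renaming (_*_ to _*ˢ_; sum to sumˢ)
  open CommutativeRing K hiding (zero)
  open SemiringMult semiring using () renaming (_×_ to _·_)
  open CommutativeMonoidSum +-commutativeMonoid using (sum; sum-cong-≋)

  infix 4 _≈ˢ_
  _≈ˢ_ : ∀ {n} → Series n → Series n → Set ℓ
  f ≈ˢ g = ∀ α → f α ≈ g α

  infixl 6 _+ˢ_
  _+ˢ_ : ∀ {n} → Series n → Series n → Series n
  (f +ˢ g) α = f α + g α

  -ˢ_ : ∀ {n} → Series n → Series n
  (-ˢ f) α = - f α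

  0ˢ 1ˢ : ∀ {n} → Series n
  0ˢ {n} = RawSemiring.0# (series-rawSemiring n)
  1ˢ {n} = RawSemiring.1# (series-rawSemiring n)

  Σ□-cong : ∀ {n} (α : Exponent n) {f g : Series n} → f ≈ˢ g → Σ□ α f ≈ Σ□ α g
  Σ□-cong []      f≈g = f≈g []
  Σ□-cong (a ∷ α) f≈g = sum-cong-≋ {suc a} λ i → Σ□-cong α λ β → f≈g (toℕ i ∷ β)

  +ˢ-isAbelianGroup : ∀ n → IsAbelianGroup (_≈ˢ_ {n}) _+ˢ_ 0ˢ -ˢ_
  +ˢ-isAbelianGroup n = record
    { isGroup = record
      { isMonoid = record
        { isSemigroup = record
          { isMagma = record
            { isEquivalence = record
              { refl  = λ _ → refl
              ; sym   = λ p α → sym (p α)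
              ; trans = λ p q α → trans (p α) (q α)
              }
            ; ∙-cong = λ p q α → +-cong (p α) (q α)
            }
          ; assoc = λ f g h α → +-assoc (f α) (g α) (h α)
          }
        ; identity = (λ f α → +-identityˡ (f α)) , (λ f α → +-identityʳ (f α))
        }
      ; inverse = (λ f α → -‿inverseˡ (f α)) , (λ f α → -‿inverseʳ (f α))
      ; ⁻¹-cong = λ p α → -‿cong (p α)
      }
    ; comm = λ f g α → +-comm (f α) (g α)
    }

  -- Bundled because the induction on the number of variables must carry all laws at once: the
  -- coefficients have to form a commutative ring before the next convolution can be taken over
  -- them.
  record MultiplicationLaws (n : ℕ) : Set (c ⊔ ℓ) where
    open Algebra.Definitions (_≈ˢ_ {n})
    field
      *-congˢ      : Congruent₂ _*ˢ_
      *-assocˢ     : Associative _*ˢ_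
      *-commˢ      : Commutative _*ˢ_
      *-identityˡˢ : LeftIdentity 1ˢ _*ˢ_
      *-distribˡˢ  : _*ˢ_ DistributesOverˡ _+ˢ_

  ringFromLaws : ∀ {n} → MultiplicationLaws n → CommutativeRing c ℓ
  ringFromLaws {n} laws = record
    { Carrier = Series n
    ; _≈_     = _≈ˢ_
    ; _+_     = _+ˢ_
    ; _*_     = _*ˢ_
    ; -_      = -ˢ_
    ; 0#      = 0ˢ
    ; 1#      = 1ˢ
    ; isCommutativeRing = record
      { isRing = record
        { +-isAbelianGroup = +ˢ-isAbelianGroup n
        ; *-cong     = *-congˢ
        ; *-assoc    = *-assocˢ
        ; *-identity = *-identityˡˢ , λ f α → trans (*-commˢ f 1ˢ α) (*-identityˡˢ f α)
        ; distrib    = *-distribˡˢ , λ f g h α → trans (*-commˢ (g +ˢ h) f α)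
            (trans (*-distribˡˢ f g h α) (+-cong (*-commˢ f g α) (*-commˢ f h α)))
        }
      ; *-comm = *-commˢ
      }
    }
    where open MultiplicationLaws laws

  -- A series in n+1 variables is the sequence of its coefficients with respect
  -- to the first variable, which are series in the other n variables.
  curry : ∀ {n} → Series (suc n) → ℕ → Series n
  curry f a α = f (a ∷ α)

  uncurry : ∀ {n} → (ℕ → Series n) → Series (suc n)
  uncurry f (a ∷ α) = f a α

  infixl 7 _⋆_
  _⋆_ : ∀ {n} → (ℕ → Series n) → (ℕ → Series n) → ℕ → Series n
  f ⋆ g = curry (uncurry f *ˢ uncurry g)

  -- `Σ□` sums over the first exponent outermost, so both recursions hold by computation, up to a
  -- trailing `0#` from the empty rest of the sum at index 0.
  module ConvolutionOfLaws {n : ℕ} (laws : MultiplicationLaws n) =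
    Convolution.Laws (ringFromLaws laws) _⋆_
      (λ _ _ _ → +-identityʳ _) (λ _ _ _ _ → refl)

  multiplicationLaws : ∀ n → MultiplicationLaws n
  multiplicationLaws zero = record
    { *-congˢ      = λ { p q [] → *-cong (p []) (q []) }
    ; *-assocˢ     = λ { f g h [] → *-assoc (f []) (g []) (h []) }
    ; *-commˢ      = λ { f g [] → *-comm (f []) (g []) }
    ; *-identityˡˢ = λ { f [] → *-identityˡ (f []) }
    ; *-distribˡˢ  = λ { f g h [] → distribˡ (f []) (g []) (h []) }
    }
  multiplicationLaws (suc n) = record
    { *-congˢ      = λ { {f} {f′} {g} {g′} p q (a ∷ α) →
        ⋆-cong {curry f} {curry f′} {curry g} {curry g′} (λ b β → p (b ∷ β)) (λ b β → q (b ∷ β)) a α }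
    ; *-assocˢ     = λ { f g h (a ∷ α) → ⋆-assoc (curry f) (curry g) (curry h) a α }
    ; *-commˢ      = λ { f g (a ∷ α) → ⋆-comm (curry f) (curry g) a α }
    ; *-identityˡˢ = λ { f (a ∷ α) → trans
        (⋆-constantˡ (curry 1ˢ) (curry f) (λ _ _ → refl) a α) (*-identityˡˢ (curry f a) α) }
    ; *-distribˡˢ  = λ { f g h (a ∷ α) → ⋆-distribˡ (curry f) (curry g) (curry h) a α }
    }
    where
    open MultiplicationLaws (multiplicationLaws n)
    open ConvolutionOfLaws (multiplicationLaws n)

  seriesRing : ℕ → CommutativeRing c ℓ
  seriesRing n = ringFromLaws (multiplicationLaws n)

  module _ {n : ℕ} where
    open CommutativeRing (seriesRing n) public using ()
      renaming (*-cong to *-congˢ; *-assoc to *-assocˢ; zeroˡ to zeroˡˢ)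
    open CommutativeRing (seriesRing n) public using ()
      renaming (*-identityˡ to *-identityˡˢ; *-identityʳ to *-identityʳˢ)
    open ConvolutionOfLaws (multiplicationLaws n) public
    open SemiringMult (CommutativeRing.semiring (seriesRing n)) public using ()
      renaming (_×_ to _·ˢ_)

  sumˢ-at : ∀ {n m} (t : Fin m → Series n) α → sumˢ t α ≡ sum (λ i → t i α)
  sumˢ-at {m = zero}  t α = ≡.refl
  sumˢ-at {m = suc m} t α = ≡.cong (t zero α +_) (sumˢ-at (t ∘ suc) α)

  ·ˢ-at : ∀ {n} k (f : Series n) α → (k ·ˢ f) α ≡ k · f α
  ·ˢ-at zero    f α = ≡.refl
  ·ˢ-at (suc k) f α = ≡.cong (f α +_) (·ˢ-at k f α)

  open CommutativeMonoidMult +-commutativeMonoid using (×-distrib-+; ×-congʳ; ×-assocˡ; ×-homo-1)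

  ∂-cong : ∀ {n} (i : Fin n) {f g} → f ≈ˢ g → ∂ i f ≈ˢ ∂ i g
  ∂-cong i f≈g α = ×-congʳ (suc (lookup α i)) (f≈g _)

  ∂-+ : ∀ {n} (i : Fin n) f g → ∂ i (f +ˢ g) ≈ˢ ∂ i f +ˢ ∂ i g
  ∂-+ i f g α = ×-distrib-+ _ _ (suc (lookup α i))

  ∂-* : ∀ {n} (i : Fin n) f g → ∂ i (f *ˢ g) ≈ˢ (∂ i f *ˢ g) +ˢ (f *ˢ ∂ i g)
  ∂-* zero f g (a ∷ α) = begin
    suc a · (f *ˢ g) (suc a ∷ α)
      ≡⟨ ·ˢ-at (suc a) ((curry f ⋆ curry g) (suc a)) α ⟨
    (suc a ·ˢ (curry f ⋆ curry g) (suc a)) α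
      ≈⟨ ⋆-leibniz (curry f) (curry g) a α ⟩
    (derivative (curry f) ⋆ curry g) a α + (curry f ⋆ derivative (curry g)) a α
      ≈⟨ +-cong (⋆-cong {_} {derivative (curry f)} {curry (∂ zero f)} {curry g} {curry g}
                  (derivative-curry f) (λ _ _ → refl) a α)
                (⋆-cong {_} {curry f} {curry f} {derivative (curry g)} {curry (∂ zero g)}
                  (λ _ _ → refl) (derivative-curry g) a α) ⟩
    (∂ zero f *ˢ g) (a ∷ α) + (f *ˢ ∂ zero g) (a ∷ α) ∎
    where
    open SetoidReasoning setoid
    derivative-curry : ∀ f b → derivative (curry f) b ≈ˢ curry (∂ zero f) b
    derivative-curry f b β = reflexive (·ˢ-at (suc b) (curry f (suc b)) β)
  ∂-* (suc i) f g (a ∷ α) = ⋆-leibniz-coefficientwise (∂ i) (∂-cong i) (∂-+ i) (∂-* i) (curry f) (curry g) a α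

  ∂-comm : ∀ {n} (i j : Fin n) f → ∂ i (∂ j f) ≈ˢ ∂ j (∂ i f)
  ∂-comm zero    zero    f α       = refl
  ∂-comm zero    (suc j) f (a ∷ α) = ·-comm (suc a) (suc (lookup α j))
    where
    ·-comm : ∀ k l {x} → k · (l · x) ≈ l · (k · x)
    ·-comm k l {x} = trans (×-assocˡ x k l)
      (trans (reflexive (≡.cong (_· x) (ℕ.*-comm k l))) (sym (×-assocˡ x l k)))
  ∂-comm (suc i) zero    f (a ∷ α) = sym (∂-comm zero (suc i) f (a ∷ α))
  ∂-comm (suc i) (suc j) f (a ∷ α) = ∂-comm i j (curry f a) α

  lift : ∀ {n} → Series n → Series (suc n)
  lift f (zero  ∷ α) = f α
  lift f (suc _ ∷ α) = 0#

  lift-* : ∀ {n} (f : Series n) g a → curry (lift f *ˢ g) a ≈ˢ f *ˢ curry g a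
  lift-* f g = ⋆-constantˡ (curry (lift f)) (curry g) (λ _ _ → refl)

  ∂-lift : ∀ {n} (i : Fin n) f → ∂ (suc i) (lift f) ≈ˢ lift (∂ i f)
  ∂-lift i f (zero  ∷ α) = refl
  ∂-lift i f (suc a ∷ α) = ×-zeroʳ +-monoid (suc (lookup α i))

  ∂-zero-lift : ∀ {n} (f : Series n) → ∂ zero (lift f) ≈ˢ 0ˢ
  ∂-zero-lift f (a ∷ α) = ×-zeroʳ +-monoid (suc a)

  lift-cong : ∀ {n} {f g : Series n} → f ≈ˢ g → lift f ≈ˢ lift g
  lift-cong f≈g (zero  ∷ α) = f≈g α
  lift-cong f≈g (suc a ∷ α) = refl

  lift-0 : ∀ {n} → lift {n} 0ˢ ≈ˢ 0ˢ
  lift-0 (zero  ∷ α) = refl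
  lift-0 (suc a ∷ α) = refl

  lift-1 : ∀ {n} → lift {n} 1ˢ ≈ˢ 1ˢ
  lift-1 (zero  ∷ α) = refl
  lift-1 (suc a ∷ α) = refl

  constant : ∀ {n} → Carrier → Series n
  constant {zero}  x _ = x
  constant {suc n} x   = lift (constant x)

  constant-* : ∀ {n} x (f : Series n) α → (constant x *ˢ f) α ≈ x * f α
  constant-* x f []      = refl
  constant-* x f (a ∷ α) = trans (lift-* (constant x) f a α) (constant-* x (curry f a) α)

  ∂-constant : ∀ {n} (i : Fin n) x → ∂ i (constant x) ≈ˢ 0ˢ
  ∂-constant zero    x α = ∂-zero-lift (constant x) α
  ∂-constant (suc i) x α = trans (∂-lift i (constant x) α) (trans (lift-cong (∂-constant i x) α) (lift-0 α))

  -- Carries division by integers from `K` to the series ring, where Euler's identity and Taylor's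
  -- formula use it.
  ·-constant : ∀ {n} k {x} → k · x ≈ 1# → k ·ˢ constant {n} x ≈ˢ 1ˢ
  ·-constant k {x} kx≈1 α = trans (reflexive (·ˢ-at k (constant x) α)) (at α)
    where
    at : ∀ {n} (α : Exponent n) → k · constant x α ≈ 1ˢ α
    at []          = kx≈1
    at (zero  ∷ α) = at α
    at (suc a ∷ α) = ×-zeroʳ +-monoid k

  x : ∀ {n} → Fin n → Series n
  x i = PolynomialMaps.coeff (PolynomialMaps.var K i)

  x-suc : ∀ {n} (i : Fin n) → x (suc i) ≈ˢ lift (x i)
  x-suc i (zero  ∷ α) = refl
  x-suc i (suc a ∷ α) = refl

  x-zero-*-zero : ∀ {n} (g : Series (suc n)) → curry (x zero *ˢ g) 0 ≈ˢ 0ˢ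
  x-zero-*-zero g α = trans (+-identityʳ _) (zeroˡˢ (curry g 0) α)

  x-zero-*-suc : ∀ {n} (g : Series (suc n)) a → curry (x zero *ˢ g) (suc a) ≈ˢ curry g a
  x-zero-*-suc g a α = trans (+-cong (zeroˡˢ (curry g (suc a)) α)
    (trans (⋆-constantˡ (curry (x zero) ∘ suc) (curry g) (λ _ _ → refl) a α) (*-identityˡˢ (curry g a) α)))
    (+-identityˡ _)

  ∂-x-same : ∀ {n} (i : Fin n) → ∂ i (x i) ≈ˢ 1ˢ
  ∂-x-same zero    (zero  ∷ α) = ×-homo-1 _
  ∂-x-same zero    (suc a ∷ α) = ×-zeroʳ +-monoid (suc (suc a))
  ∂-x-same (suc i) α = trans (∂-cong (suc i) (x-suc i) α)
    (trans (∂-lift i (x i) α) (trans (lift-cong (∂-x-same i) α) (lift-1 α)))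

  ∂-x-distinct : ∀ {n} (i j : Fin n) → i ≢ j → ∂ i (x j) ≈ˢ 0ˢ
  ∂-x-distinct zero    zero    i≢j = contradiction ≡.refl i≢j
  ∂-x-distinct zero    (suc j) i≢j α = trans (∂-cong zero (x-suc j) α) (∂-zero-lift (x j) α)
  ∂-x-distinct (suc i) zero    i≢j (zero ∷ α) = ×-zeroʳ +-monoid (suc (lookup α i))
  ∂-x-distinct (suc i) zero    i≢j (suc zero ∷ α) = trans
    (∂-cong {_} i {1ˢ} {constant 1#} (λ β → sym (1ˢ≈ β)) α)
    (∂-constant i 1# α)
    where
    1ˢ≈ : ∀ {n} → constant {n} 1# ≈ˢ 1ˢ
    1ˢ≈ []          = refl
    1ˢ≈ (zero  ∷ α) = 1ˢ≈ α
    1ˢ≈ (suc a ∷ α) = refl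
  ∂-x-distinct (suc i) zero    i≢j (suc (suc a) ∷ α) = ×-zeroʳ +-monoid (suc (lookup α i))
  ∂-x-distinct (suc i) (suc j) i≢j α = trans (∂-cong (suc i) (x-suc j) α)
    (trans (∂-lift i (x j) α) (trans (lift-cong (∂-x-distinct i j (i≢j ∘ ≡.cong suc)) α) (lift-0 α)))

-- Calculus along vector fields in a ring with commuting derivations.

module DifferentialRing {c ℓ} (S : CommutativeRing c ℓ) where

  open CommutativeRing S hiding (zero)

  module Derivations {n : ℕ} (∂ : Fin n → Carrier → Carrier)
    (∂-cong : ∀ (i : Fin n) {f g : Carrier} → f ≈ g → ∂ i f ≈ ∂ i g)
    (∂-+ : ∀ (i : Fin n) (f g : Carrier) → ∂ i (f + g) ≈ ∂ i f + ∂ i g)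
    (∂-* : ∀ (i : Fin n) (f g : Carrier) → ∂ i (f * g) ≈ ∂ i f * g + f * ∂ i g)
    (∂-comm : ∀ (i j : Fin n) (f : Carrier) → ∂ i (∂ j f) ≈ ∂ j (∂ i f))
    where

    open SetoidReasoning setoid
    open CommutativeSemigroupProperties +-commutativeSemigroup
      using (interchange; x∙yz≈y∙xz)
    open CommutativeSemigroupProperties *-commutativeSemigroup using ()
      renaming (x∙yz≈y∙xz to x*yz≈y*xz)
    open GroupProperties +-group using (identityʳ-unique; inverseˡ-unique)
    open RingProperties ring using (-‿distribˡ-*; -‿distribʳ-*; -‿+-comm; -0#≈0#)
    open SemiringSum semiring using (sum; sum-cong-≋; sum-replicate-zero; ∑-distrib-+; ∑-comm)
    open SemiringSum semiring using (*-distribˡ-sum; *-distribʳ-sum)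
    open SemiringMult semiring using (×-homo-1; ×-congʳ; ×-comm-*; ×-assoc-*) renaming (_×_ to _·_)
    open CommutativeMonoidMult +-commutativeMonoid using (×-distrib-+)

    Vector : Set c
    Vector = Fin n → Carrier

    infix 4 _≋_
    _≋_ : Vector → Vector → Set ℓ
    V ≋ W = ∀ i → V i ≈ W i

    Symmetric : Vector → Set ℓ
    Symmetric W = ∀ i j → ∂ i (W j) ≈ ∂ j (W i)

    Constant : Carrier → Set ℓ
    Constant x = ∀ i → ∂ i x ≈ 0#

    -- The length is fixed to n because Agda cannot infer it from a sum.
    ∑-cong : {s t : Vector} → s ≋ t → sum s ≈ sum t
    ∑-cong = sum-cong-≋

    sum-zero : {t : Vector} → (∀ i → t i ≈ 0#) → sum t ≈ 0#
    sum-zero t≈0 = trans (∑-cong t≈0) (sum-replicate-zero n)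

    ×-distrib-sum : ∀ k {m} (t : Fin m → Carrier) → k · sum t ≈ sum (λ i → k · t i)
    ×-distrib-sum k {zero}  t = ×-zeroʳ +-monoid k
    ×-distrib-sum k {suc m} t = trans (×-distrib-+ _ _ k) (+-congˡ (×-distrib-sum k (t ∘ suc)))

    sum-*-swap : ∀ (u v : Vector) (M : Fin n → Vector) →
      sum (λ i → u i * sum (λ j → v j * M i j)) ≈ sum (λ j → v j * sum (λ i → u i * M i j))
    sum-*-swap u v M = begin
      sum (λ i → u i * sum (λ j → v j * M i j))
        ≈⟨ ∑-cong (λ i → *-distribˡ-sum (u i) (λ j → v j * M i j)) ⟩
      sum (λ i → sum (λ j → u i * (v j * M i j)))    ≈⟨ ∑-comm (λ i j → u i * (v j * M i j)) ⟩
      sum (λ j → sum (λ i → u i * (v j * M i j)))    ≈⟨ ∑-cong (λ j → ∑-cong λ i → x*yz≈y*xz _ _ _) ⟩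
      sum (λ j → sum (λ i → v j * (u i * M i j)))
        ≈⟨ ∑-cong (λ j → *-distribˡ-sum (v j) (λ i → u i * M i j)) ⟨
      sum (λ j → v j * sum (λ i → u i * M i j))      ∎

    sum-*-assoc : ∀ (u : Vector) (M : Fin n → Vector) (v : Vector) →
      sum (λ j → sum (λ i → u i * M i j) * v j) ≈ sum (λ i → u i * sum (λ j → M i j * v j))
    sum-*-assoc u M v = begin
      sum (λ j → sum (λ i → u i * M i j) * v j)    ≈⟨ ∑-cong (λ j → *-comm _ _) ⟩
      sum (λ j → v j * sum (λ i → u i * M i j))    ≈⟨ sum-*-swap u v M ⟨
      sum (λ i → u i * sum (λ j → v j * M i j))
        ≈⟨ ∑-cong (λ i → *-congˡ (∑-cong λ j → *-comm (v j) (M i j))) ⟩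
      sum (λ i → u i * sum (λ j → M i j * v j))    ∎

    symmetric-+ : ∀ {V W} → Symmetric V → Symmetric W → Symmetric (λ i → V i + W i)
    symmetric-+ symV symW i j =
      trans (∂-+ i _ _) (trans (+-cong (symV i j) (symW i j)) (sym (∂-+ j _ _)))

    ∂-0 : ∀ i → ∂ i 0# ≈ 0#
    ∂-0 i = identityʳ-unique _ _ (trans (sym (∂-+ i 0# 0#)) (∂-cong i (+-identityʳ 0#)))

    ∂-neg : ∀ i f → ∂ i (- f) ≈ - ∂ i f
    ∂-neg i f = inverseˡ-unique _ _
      (trans (sym (∂-+ i (- f) f)) (trans (∂-cong i (-‿inverseˡ f)) (∂-0 i)))

    ∂-sum : ∀ i {m} (t : Fin m → Carrier) → ∂ i (sum t) ≈ sum (λ j → ∂ i (t j))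
    ∂-sum i {zero}  t = ∂-0 i
    ∂-sum i {suc m} t = trans (∂-+ i _ _) (+-congˡ (∂-sum i (t ∘ suc)))

    ∂-1 : Constant 1#
    ∂-1 i = identityʳ-unique _ _ (begin
      ∂ i 1# + ∂ i 1#               ≈⟨ +-cong (*-identityʳ _) (*-identityˡ _) ⟨
      ∂ i 1# * 1# + 1# * ∂ i 1#     ≈⟨ ∂-* i 1# 1# ⟨
      ∂ i (1# * 1#)                 ≈⟨ ∂-cong i (*-identityʳ 1#) ⟩
      ∂ i 1#                        ∎)

    ∂-sum-* : ∀ i (s t : Vector) →
      ∂ i (sum (λ j → s j * t j)) ≈ sum (λ j → ∂ i (s j) * t j) + sum (λ j → s j * ∂ i (t j))
    ∂-sum-* i s t = begin
      ∂ i (sum (λ j → s j * t j))                              ≈⟨ ∂-sum i (λ j → s j * t j) ⟩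
      sum (λ j → ∂ i (s j * t j))                              ≈⟨ ∑-cong (λ j → ∂-* i (s j) (t j)) ⟩
      sum (λ j → ∂ i (s j) * t j + s j * ∂ i (t j))
        ≈⟨ ∑-distrib-+ (λ j → ∂ i (s j) * t j) (λ j → s j * ∂ i (t j)) ⟩
      sum (λ j → ∂ i (s j) * t j) + sum (λ j → s j * ∂ i (t j)) ∎

    D : Vector → Carrier → Carrier
    D V f = sum λ j → V j * ∂ j f

    D-cong : ∀ {V W f g} → V ≋ W → f ≈ g → D V f ≈ D W g
    D-cong V≋W f≈g = ∑-cong λ j → *-cong (V≋W j) (∂-cong j f≈g)

    D-+ : ∀ V f g → D V (f + g) ≈ D V f + D V g
    D-+ V f g = trans (∑-cong λ j → trans (*-congˡ (∂-+ j f g)) (distribˡ _ _ _))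
      (∑-distrib-+ (λ j → V j * ∂ j f) (λ j → V j * ∂ j g))

    D-+ˡ : ∀ V W f → D (λ j → V j + W j) f ≈ D V f + D W f
    D-+ˡ V W f = trans (∑-cong λ j → distribʳ _ _ _)
      (∑-distrib-+ (λ j → V j * ∂ j f) (λ j → W j * ∂ j f))

    D-0 : ∀ V → D V 0# ≈ 0#
    D-0 V = sum-zero λ j → trans (*-congˡ (∂-0 j)) (zeroʳ _)

    D-neg : ∀ V f → D V (- f) ≈ - D V f
    D-neg V f = inverseˡ-unique _ _
      (trans (sym (D-+ V (- f) f)) (trans (D-cong (λ _ → refl) (-‿inverseˡ f)) (D-0 V)))

    D-negˡ : ∀ V f → D (λ j → - V j) f ≈ - D V f
    D-negˡ V f = begin
      sum (λ j → - V j * ∂ j f)     ≈⟨ ∑-cong (λ j → trans (sym (-‿distribˡ-* _ _)) (-‿distribʳ-* _ _)) ⟩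
      sum (λ j → V j * - ∂ j f)     ≈⟨ ∑-cong (λ j → *-congˡ (∂-neg j f)) ⟨
      D V (- f)                     ≈⟨ D-neg V f ⟩
      - D V f                       ∎

    -- The k-th derivative along V with the coefficients of V frozen, that is
    -- k! times the coefficient of tᵏ in f (X + t V).
    Dᶠ : ℕ → Vector → Carrier → Carrier
    Dᶠ zero    V f = f
    Dᶠ (suc k) V f = sum λ j → V j * Dᶠ k V (∂ j f)

    Dᶠ-cong : ∀ k V {f g} → f ≈ g → Dᶠ k V f ≈ Dᶠ k V g
    Dᶠ-cong zero    V f≈g = f≈g
    Dᶠ-cong (suc k) V f≈g = ∑-cong λ j → *-congˡ (Dᶠ-cong k V (∂-cong j f≈g))

    Dᶠ-+ : ∀ k V f g → Dᶠ k V (f + g) ≈ Dᶠ k V f + Dᶠ k V g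
    Dᶠ-+ zero    V f g = refl
    Dᶠ-+ (suc k) V f g = trans
      (∑-cong λ j → trans (*-congˡ (trans (Dᶠ-cong k V (∂-+ j f g)) (Dᶠ-+ k V (∂ j f) (∂ j g)))) (distribˡ _ _ _))
      (∑-distrib-+ (λ j → V j * Dᶠ k V (∂ j f)) (λ j → V j * Dᶠ k V (∂ j g)))

    Dᶠ-constant-* : ∀ k V {x} f → Constant x → Dᶠ k V (x * f) ≈ x * Dᶠ k V f
    Dᶠ-constant-* zero    V f ∂x≈0 = refl
    Dᶠ-constant-* (suc k) V {x} f ∂x≈0 = begin
      sum (λ j → V j * Dᶠ k V (∂ j (x * f)))    ≈⟨ ∑-cong (λ j → *-congˡ (Dᶠ-cong k V (∂x*f≈x*∂f j))) ⟩
      sum (λ j → V j * Dᶠ k V (x * ∂ j f))      ≈⟨ ∑-cong (λ j → *-congˡ (Dᶠ-constant-* k V (∂ j f) ∂x≈0)) ⟩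
      sum (λ j → V j * (x * Dᶠ k V (∂ j f)))    ≈⟨ ∑-cong (λ j → x*yz≈y*xz _ _ _) ⟩
      sum (λ j → x * (V j * Dᶠ k V (∂ j f)))    ≈⟨ *-distribˡ-sum x (λ j → V j * Dᶠ k V (∂ j f)) ⟨
      x * sum (λ j → V j * Dᶠ k V (∂ j f))      ∎
      where
      ∂x*f≈x*∂f : ∀ j → ∂ j (x * f) ≈ x * ∂ j f
      ∂x*f≈x*∂f j = trans (∂-* j x f) (trans (+-congʳ (trans (*-congʳ (∂x≈0 j)) (zeroˡ f))) (+-identityˡ _))

    Dᶠ-zero : ∀ k V {f} → f ≈ 0# → Dᶠ k V f ≈ 0#
    Dᶠ-zero zero    V f≈0 = f≈0
    Dᶠ-zero (suc k) V f≈0 = sum-zero λ j → trans (*-congˡ (Dᶠ-zero k V (trans (∂-cong j f≈0) (∂-0 j)))) (zeroʳ _)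

    -- By the product rule `∂ j` hits either `f` or one of the `suc k` coefficients taken from `V`.
    -- The latter contributions all agree because the derivations commute, which is the content of
    -- `swap`.
    ∂-Dᶠ : ∀ k V j f →
      ∂ j (Dᶠ (suc k) V f) ≈ Dᶠ (suc k) V (∂ j f) + suc k · sum (λ l → ∂ j (V l) * Dᶠ k V (∂ l f))
    ∂-Dᶠ zero V j f = begin
      ∂ j (D V f)                                                      ≈⟨ ∂-sum-* j V (λ l → ∂ l f) ⟩
      sum (λ l → ∂ j (V l) * ∂ l f) + sum (λ l → V l * ∂ j (∂ l f))
        ≈⟨ +-congˡ (∑-cong λ l → *-congˡ (∂-comm j l f)) ⟩
      sum (λ l → ∂ j (V l) * ∂ l f) + D V (∂ j f)                      ≈⟨ +-comm _ _ ⟩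
      D V (∂ j f) + sum (λ l → ∂ j (V l) * ∂ l f)                      ≈⟨ +-congˡ (×-homo-1 _) ⟨
      D V (∂ j f) + 1 · sum (λ l → ∂ j (V l) * ∂ l f)                  ∎
    ∂-Dᶠ (suc k) V j f = begin
      ∂ j (Dᶠ (suc (suc k)) V f)
        ≈⟨ ∂-sum-* j V (λ l → Dᶠ (suc k) V (∂ l f)) ⟩
      E (suc k) f + sum (λ l → V l * ∂ j (Dᶠ (suc k) V (∂ l f)))
        ≈⟨ +-congˡ (∑-cong λ l → *-congˡ (trans (∂-Dᶠ k V j (∂ l f)) (+-congʳ (Dᶠ-cong (suc k) V (∂-comm j l f))))) ⟩
      E (suc k) f + sum (λ l → V l * (Dᶠ (suc k) V (∂ l (∂ j f)) + suc k · E k (∂ l f)))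
        ≈⟨ +-congˡ (∑-cong λ l → trans (distribˡ _ _ _) (+-congˡ (×-comm-* (suc k) _ _))) ⟩
      E (suc k) f + sum (λ l → V l * Dᶠ (suc k) V (∂ l (∂ j f)) + suc k · (V l * E k (∂ l f)))
        ≈⟨ +-congˡ (∑-distrib-+ (λ l → V l * Dᶠ (suc k) V (∂ l (∂ j f))) (λ l → suc k · (V l * E k (∂ l f)))) ⟩
      E (suc k) f + (Dᶠ (suc (suc k)) V (∂ j f) + sum (λ l → suc k · (V l * E k (∂ l f))))
        ≈⟨ +-congˡ (+-congˡ (×-distrib-sum (suc k) (λ l → V l * E k (∂ l f)))) ⟨
      E (suc k) f + (Dᶠ (suc (suc k)) V (∂ j f) + suc k · sum (λ l → V l * E k (∂ l f)))
        ≈⟨ +-congˡ (+-congˡ (×-congʳ (suc k) swap)) ⟩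
      E (suc k) f + (Dᶠ (suc (suc k)) V (∂ j f) + suc k · E (suc k) f)
        ≈⟨ x∙yz≈y∙xz _ _ _ ⟩
      Dᶠ (suc (suc k)) V (∂ j f) + suc (suc k) · E (suc k) f ∎
      where
      E : ℕ → Carrier → Carrier
      E m g = sum λ l → ∂ j (V l) * Dᶠ m V (∂ l g)
      swap : sum (λ l → V l * E k (∂ l f)) ≈ E (suc k) f
      swap = trans (sum-*-swap V (∂ j ∘ V) (λ l m → Dᶠ k V (∂ m (∂ l f))))
        (∑-cong λ m → *-congˡ (∑-cong λ l → *-congˡ (Dᶠ-cong k V (∂-comm m l f))))

    -- Differentiating the vanishing (k+1)-st derivative of W a in direction a
    -- trades a derivative of W for a derivative of V; by the symmetry of JW,
    -- contracting with V reproduces (k+1)-st derivatives.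
    Dᶠ-vanishes : ∀ k V {W} → Symmetric W →
      (∀ a → Dᶠ (suc k) V (W a) ≈ 0#) → ∀ a → Dᶠ (suc (suc k)) V (W a) ≈ 0#
    Dᶠ-vanishes k V {W} symW DW≈0 a = begin
      sum (λ j → V j * Dᶠ (suc k) V (∂ j (W a)))
        ≈⟨ ∑-cong (λ j → *-congˡ (Dᶠ-cong (suc k) V (symW j a))) ⟩
      sum (λ j → V j * Dᶠ (suc k) V (∂ a (W j)))
        ≈⟨ +-identityʳ _ ⟨
      sum (λ j → V j * Dᶠ (suc k) V (∂ a (W j))) + 0#
        ≈⟨ +-congˡ ΣVE≈0 ⟨
      sum (λ j → V j * Dᶠ (suc k) V (∂ a (W j))) + sum (λ j → V j * (suc k · E j))
        ≈⟨ ∑-distrib-+ (λ j → V j * Dᶠ (suc k) V (∂ a (W j))) (λ j → V j * (suc k · E j)) ⟨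
      sum (λ j → V j * Dᶠ (suc k) V (∂ a (W j)) + V j * (suc k · E j))
        ≈⟨ ∑-cong (λ j → trans (sym (distribˡ _ _ _)) (*-congˡ (sym (∂-Dᶠ k V a (W j))))) ⟩
      sum (λ j → V j * ∂ a (Dᶠ (suc k) V (W j)))
        ≈⟨ sum-zero (λ j → trans (*-congˡ (trans (∂-cong a (DW≈0 j)) (∂-0 a))) (zeroʳ _)) ⟩
      0# ∎
      where
      E : Fin n → Carrier
      E j = sum λ l → ∂ a (V l) * Dᶠ k V (∂ l (W j))
      ΣVE≈0 : sum (λ j → V j * (suc k · E j)) ≈ 0#
      ΣVE≈0 = begin
        sum (λ j → V j * (suc k · E j))
          ≈⟨ ∑-cong (λ j → ×-comm-* (suc k) _ _) ⟩
        sum (λ j → suc k · (V j * E j))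
          ≈⟨ ×-distrib-sum (suc k) (λ j → V j * E j) ⟨
        suc k · sum (λ j → V j * E j)
          ≈⟨ ×-congʳ (suc k) (sum-*-swap V (∂ a ∘ V) (λ j l → Dᶠ k V (∂ l (W j)))) ⟩
        suc k · sum (λ l → ∂ a (V l) * sum (λ j → V j * Dᶠ k V (∂ l (W j))))
          ≈⟨ ×-congʳ (suc k) (sum-zero λ l → trans (*-congˡ (trans
               (∑-cong λ j → *-congˡ (Dᶠ-cong k V (symW l j))) (DW≈0 l))) (zeroʳ _)) ⟩
        suc k · 0#
          ≈⟨ ×-zeroʳ +-monoid (suc k) ⟩
        0# ∎

    Dᶠ-vanishes-from-2 : ∀ V {W} → Symmetric W → (∀ a → Dᶠ 2 V (W a) ≈ 0#) →
      ∀ k a → Dᶠ (suc (suc k)) V (W a) ≈ 0#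
    Dᶠ-vanishes-from-2 V symW D²W≈0 zero    = D²W≈0
    Dᶠ-vanishes-from-2 V symW D²W≈0 (suc k) =
      Dᶠ-vanishes (suc k) V symW (Dᶠ-vanishes-from-2 V symW D²W≈0 k)

    D∘D : ∀ V f → D V (D V f) ≈ Dᶠ 2 V f + D (D V ∘ V) f
    D∘D V f = begin
      sum (λ j → V j * ∂ j (D V f))
        ≈⟨ ∑-cong (λ j → *-congˡ (∂-sum-* j V (λ l → ∂ l f))) ⟩
      sum (λ j → V j * (sum (λ l → ∂ j (V l) * ∂ l f) + sum (λ l → V l * ∂ j (∂ l f))))
        ≈⟨ ∑-cong (λ j → distribˡ _ _ _) ⟩
      sum (λ j → V j * sum (λ l → ∂ j (V l) * ∂ l f) + V j * sum (λ l → V l * ∂ j (∂ l f)))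
        ≈⟨ ∑-distrib-+ (λ j → V j * sum (λ l → ∂ j (V l) * ∂ l f)) (λ j → V j * sum (λ l → V l * ∂ j (∂ l f))) ⟩
      sum (λ j → V j * sum (λ l → ∂ j (V l) * ∂ l f)) + sum (λ j → V j * sum (λ l → V l * ∂ j (∂ l f)))
        ≈⟨ +-cong (sym (sum-*-assoc V (λ j l → ∂ j (V l)) (λ l → ∂ l f)))
                  (∑-cong λ j → *-congˡ (∑-cong λ l → *-congˡ (∂-comm j l f))) ⟩
      D (D V ∘ V) f + Dᶠ 2 V f
        ≈⟨ +-comm _ _ ⟩
      Dᶠ 2 V f + D (D V ∘ V) f ∎

    Affine : Carrier → Set ℓ
    Affine x = ∀ i → Constant (∂ i x)

    -- In the Leibniz expansion only the terms with at most one derivative on `x` survive, and there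
    -- are `suc k` ways to choose that derivative.
    Dᶠ-affine-* : ∀ k V {x} → Affine x → ∀ f →
      Dᶠ (suc k) V (x * f) ≈ x * Dᶠ (suc k) V f + suc k · (D V x * Dᶠ k V f)
    Dᶠ-affine-* k V {x} ∂∂x≈0 f = begin
      sum (λ j → V j * Dᶠ k V (∂ j (x * f)))
        ≈⟨ ∑-cong (λ j → *-congˡ (trans (Dᶠ-cong k V (∂-* j x f)) (Dᶠ-+ k V _ _))) ⟩
      sum (λ j → V j * (Dᶠ k V (∂ j x * f) + Dᶠ k V (x * ∂ j f)))
        ≈⟨ ∑-cong (λ j → distribˡ _ _ _) ⟩
      sum (λ j → V j * Dᶠ k V (∂ j x * f) + V j * Dᶠ k V (x * ∂ j f))
        ≈⟨ ∑-distrib-+ (λ j → V j * Dᶠ k V (∂ j x * f)) (λ j → V j * Dᶠ k V (x * ∂ j f)) ⟩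
      sum (λ j → V j * Dᶠ k V (∂ j x * f)) + sum (λ j → V j * Dᶠ k V (x * ∂ j f))
        ≈⟨ +-cong first (second k) ⟩
      D V x * Dᶠ k V f + (x * Dᶠ (suc k) V f + k · (D V x * Dᶠ k V f))
        ≈⟨ x∙yz≈y∙xz _ _ _ ⟩
      x * Dᶠ (suc k) V f + suc k · (D V x * Dᶠ k V f) ∎
      where
      first : sum (λ j → V j * Dᶠ k V (∂ j x * f)) ≈ D V x * Dᶠ k V f
      first = begin
        sum (λ j → V j * Dᶠ k V (∂ j x * f))      ≈⟨ ∑-cong (λ j → *-congˡ (Dᶠ-constant-* k V f (∂∂x≈0 j))) ⟩
        sum (λ j → V j * (∂ j x * Dᶠ k V f))      ≈⟨ ∑-cong (λ j → *-assoc _ _ _) ⟨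
        sum (λ j → V j * ∂ j x * Dᶠ k V f)        ≈⟨ *-distribʳ-sum _ (λ j → V j * ∂ j x) ⟨
        D V x * Dᶠ k V f                          ∎
      x*Σ : ∀ m → sum (λ j → V j * (x * Dᶠ m V (∂ j f))) ≈ x * Dᶠ (suc m) V f
      x*Σ m = trans (∑-cong λ j → x*yz≈y*xz _ _ _) (sym (*-distribˡ-sum x (λ j → V j * Dᶠ m V (∂ j f))))
      -- The factor is `k`, not `suc k`: the outermost derivative has already gone to `f`, and the
      -- case in which it goes to `x` is `first`.
      second : ∀ k → sum (λ j → V j * Dᶠ k V (x * ∂ j f)) ≈ x * Dᶠ (suc k) V f + k · (D V x * Dᶠ k V f)
      second zero    = trans (x*Σ 0) (sym (+-identityʳ _))
      second (suc k) = begin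
        sum (λ j → V j * Dᶠ (suc k) V (x * ∂ j f))
          ≈⟨ ∑-cong (λ j → *-congˡ (Dᶠ-affine-* k V ∂∂x≈0 (∂ j f))) ⟩
        sum (λ j → V j * (x * Dᶠ (suc k) V (∂ j f) + suc k · (D V x * Dᶠ k V (∂ j f))))
          ≈⟨ ∑-cong (λ j → trans (distribˡ _ _ _) (+-congˡ (trans (×-comm-* (suc k) _ _) (×-congʳ (suc k) (x*yz≈y*xz _ _ _))))) ⟩
        sum (λ j → V j * (x * Dᶠ (suc k) V (∂ j f)) + suc k · (D V x * (V j * Dᶠ k V (∂ j f))))
          ≈⟨ ∑-distrib-+ (λ j → V j * (x * Dᶠ (suc k) V (∂ j f))) (λ j → suc k · (D V x * (V j * Dᶠ k V (∂ j f)))) ⟩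
        sum (λ j → V j * (x * Dᶠ (suc k) V (∂ j f))) + sum (λ j → suc k · (D V x * (V j * Dᶠ k V (∂ j f))))
          ≈⟨ +-cong (x*Σ (suc k)) (sym (×-distrib-sum (suc k) (λ j → D V x * (V j * Dᶠ k V (∂ j f))))) ⟩
        x * Dᶠ (suc (suc k)) V f + suc k · sum (λ j → D V x * (V j * Dᶠ k V (∂ j f)))
          ≈⟨ +-congˡ (×-congʳ (suc k) (*-distribˡ-sum (D V x) (λ j → V j * Dᶠ k V (∂ j f)))) ⟨
        x * Dᶠ (suc (suc k)) V f + suc k · (D V x * Dᶠ (suc k) V f) ∎

    -- Taylor polynomials and Taylor sums.

    module WithReciprocals (recip : ℕ → Carrier) (recip-inverse : ∀ k → suc k · recip k ≈ 1#) where

      ×-cancel : ∀ k {f} → suc k · f ≈ 0# → f ≈ 0#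
      ×-cancel k {f} kf≈0 = begin
        f                          ≈⟨ *-identityˡ f ⟨
        1# * f                     ≈⟨ *-congʳ (recip-inverse k) ⟨
        (suc k · recip k) * f      ≈⟨ ×-assoc-* (suc k) _ _ ⟩
        suc k · (recip k * f)      ≈⟨ ×-comm-* (suc k) _ _ ⟨
        recip k * (suc k · f)      ≈⟨ *-congˡ kf≈0 ⟩
        recip k * 0#               ≈⟨ zeroʳ _ ⟩
        0#                         ∎

      recip! : ℕ → Carrier
      recip! zero    = 1#
      recip! (suc k) = recip k * recip! k

      recip!-suc : ∀ k → suc k · recip! (suc k) ≈ recip! k
      recip!-suc k = trans (sym (×-assoc-* (suc k) _ _)) (trans (*-congʳ (recip-inverse k)) (*-identityˡ _))

      taylorTerm : ℕ → Vector → Carrier → Carrier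
      taylorTerm k V f = recip! k * Dᶠ k V f

      taylor : ℕ → Vector → Carrier → Carrier
      taylor zero    V f = taylorTerm zero V f
      taylor (suc m) V f = taylor m V f + taylorTerm (suc m) V f

      taylorTerm-affine-* : ∀ k V {x} → Affine x → ∀ f →
        taylorTerm (suc k) V (x * f) ≈ x * taylorTerm (suc k) V f + D V x * taylorTerm k V f
      taylorTerm-affine-* k V {x} aff f = begin
        recip! (suc k) * Dᶠ (suc k) V (x * f)
          ≈⟨ *-congˡ (Dᶠ-affine-* k V aff f) ⟩
        recip! (suc k) * (x * Dᶠ (suc k) V f + suc k · (D V x * Dᶠ k V f))
          ≈⟨ distribˡ _ _ _ ⟩
        recip! (suc k) * (x * Dᶠ (suc k) V f) + recip! (suc k) * (suc k · (D V x * Dᶠ k V f))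
          ≈⟨ +-cong (x*yz≈y*xz _ _ _) (trans (×-comm-* (suc k) _ _) (sym (×-assoc-* (suc k) _ _))) ⟩
        x * taylorTerm (suc k) V f + (suc k · recip! (suc k)) * (D V x * Dᶠ k V f)
          ≈⟨ +-congˡ (trans (*-congʳ (recip!-suc k)) (x*yz≈y*xz _ _ _)) ⟩
        x * taylorTerm (suc k) V f + D V x * taylorTerm k V f ∎

      -- This is (x + t D V x) times the Taylor expansion of `f`, cut off at order `suc m` in t; the
      -- factor t lowers the cut-off of the second summand to `m`.
      taylor-affine-* : ∀ m V {x} → Affine x → ∀ f →
        taylor (suc m) V (x * f) ≈ x * taylor (suc m) V f + D V x * taylor m V f
      taylor-affine-* zero V {x} aff f = begin
        1# * (x * f) + taylorTerm 1 V (x * f)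
          ≈⟨ +-cong (x*yz≈y*xz _ _ _) (taylorTerm-affine-* 0 V aff f) ⟩
        x * (1# * f) + (x * taylorTerm 1 V f + D V x * taylorTerm 0 V f)
          ≈⟨ +-assoc _ _ _ ⟨
        x * (1# * f) + x * taylorTerm 1 V f + D V x * taylorTerm 0 V f
          ≈⟨ +-congʳ (distribˡ _ _ _) ⟨
        x * taylor 1 V f + D V x * taylor 0 V f ∎
      taylor-affine-* (suc m) V {x} aff f = begin
        taylor (suc m) V (x * f) + taylorTerm (suc (suc m)) V (x * f)
          ≈⟨ +-cong (taylor-affine-* m V aff f) (taylorTerm-affine-* (suc m) V aff f) ⟩
        (x * taylor (suc m) V f + D V x * taylor m V f) + (x * taylorTerm (suc (suc m)) V f + D V x * taylorTerm (suc m) V f)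
          ≈⟨ interchange _ _ _ _ ⟩
        (x * taylor (suc m) V f + x * taylorTerm (suc (suc m)) V f) + (D V x * taylor m V f + D V x * taylorTerm (suc m) V f)
          ≈⟨ +-cong (distribˡ _ _ _) (distribˡ _ _ _) ⟨
        x * taylor (suc (suc m)) V f + D V x * taylor (suc m) V f ∎

      taylor-cong : ∀ m V {f g} → f ≈ g → taylor m V f ≈ taylor m V g
      taylor-cong zero    V f≈g = *-congˡ f≈g
      taylor-cong (suc m) V f≈g = +-cong (taylor-cong m V f≈g) (*-congˡ (Dᶠ-cong (suc m) V f≈g))

      taylor-+ : ∀ m V f g → taylor m V (f + g) ≈ taylor m V f + taylor m V g
      taylor-+ zero    V f g = distribˡ _ _ _
      taylor-+ (suc m) V f g = trans
        (+-cong (taylor-+ m V f g) (trans (*-congˡ (Dᶠ-+ (suc m) V f g)) (distribˡ _ _ _)))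
        (interchange _ _ _ _)

      taylor-constant-* : ∀ m V {x} f → Constant x → taylor m V (x * f) ≈ x * taylor m V f
      taylor-constant-* zero    V f ∂x≈0 = x*yz≈y*xz _ _ _
      taylor-constant-* (suc m) V f ∂x≈0 = trans
        (+-cong (taylor-constant-* m V f ∂x≈0) (trans (*-congˡ (Dᶠ-constant-* (suc m) V f ∂x≈0)) (x*yz≈y*xz _ _ _)))
        (sym (distribˡ _ _ _))

      taylor-truncates : ∀ m V {f} → (∀ k → m < k → Dᶠ k V f ≈ 0#) → ∀ M → m ≤ M → taylor M V f ≈ taylor m V f
      taylor-truncates m V {f} vanish M m≤M = go (ℕ.≤⇒≤′ m≤M)
        where
        go : ∀ {M} → m ℕ.≤′ M → taylor M V f ≈ taylor m V f
        go (ℕ.≤′-reflexive ≡.refl) = refl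
        go {suc M} (ℕ.≤′-step m≤M) = trans
            (+-cong (go m≤M) (trans (*-congˡ (vanish (suc M) (s≤s (ℕ.≤′⇒≤ m≤M)))) (zeroʳ _)))
            (+-identityʳ _)

      -- The value of the infinite Taylor series, encoded as eventual constancy of the partial sums,
      -- so that no notion of convergence enters. The threshold is existential because it grows with
      -- every factor of a monomial.
      HasTaylorSum : Vector → Carrier → Carrier → Set ℓ
      HasTaylorSum V f s = Σ[ m ∈ ℕ ] (∀ M → m ≤ M → taylor M V f ≈ s)

      taylorSum-cong : ∀ V {f g s t} → f ≈ g → s ≈ t → HasTaylorSum V f s → HasTaylorSum V g t
      taylorSum-cong V f≈g s≈t (m , p) = m , λ M m≤M → trans (taylor-cong M V (sym f≈g)) (trans (p M m≤M) s≈t)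

      taylorSum-constant : ∀ V {x} → Constant x → HasTaylorSum V x x
      taylorSum-constant V {x} ∂x≈0 = 0 , λ M 0≤M → trans (taylor-truncates 0 V vanish M 0≤M) (*-identityˡ x)
        where
        vanish : ∀ k → 0 < k → Dᶠ k V x ≈ 0#
        vanish (suc k) _ = sum-zero λ j → trans (*-congˡ (Dᶠ-zero k V (∂x≈0 j))) (zeroʳ _)

      taylorSum-+ : ∀ V {f g s t} → HasTaylorSum V f s → HasTaylorSum V g t → HasTaylorSum V (f + g) (s + t)
      taylorSum-+ V (m , p) (m′ , q) = m ℕ.⊔ m′ , λ M le → trans (taylor-+ M V _ _)
        (+-cong (p M (ℕ.m⊔n≤o⇒m≤o m m′ le)) (q M (ℕ.m⊔n≤o⇒n≤o m m′ le)))

      taylorSum-constant-* : ∀ V {x f s} → Constant x → HasTaylorSum V f s → HasTaylorSum V (x * f) (x * s)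
      taylorSum-constant-* V ∂x≈0 (m , p) = m , λ M m≤M →
        trans (taylor-constant-* M V _ ∂x≈0) (*-congˡ (p M m≤M))

      taylorSum-affine-* : ∀ V {x f s} → Affine x → HasTaylorSum V f s → HasTaylorSum V (x * f) ((x + D V x) * s)
      taylorSum-affine-* V {x} aff (m , p) = suc m , λ { (suc M) (s≤s m≤M) → trans (taylor-affine-* M V aff _)
        (trans (+-cong (*-congˡ (p (suc M) (ℕ.m≤n⇒m≤1+n m≤M))) (*-congˡ (p M m≤M))) (sym (distribʳ _ _ _))) }

      taylorSum-first-order : ∀ V {f s} → (∀ k → Dᶠ (suc (suc k)) V f ≈ 0#) → HasTaylorSum V f s → s ≈ f + D V f
      taylorSum-first-order V {f} {s} vanish (m , p) = begin
        -- The order `suc m` is past the threshold of the Taylor sum and also at least 1, where the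
        -- vanishing derivatives begin to be discarded.
        s                        ≈⟨ p (suc m) (ℕ.n≤1+n m) ⟨
        taylor (suc m) V f
          ≈⟨ taylor-truncates 1 V (λ { (suc (suc k)) _ → vanish k ; (suc zero) (s≤s ()) }) (suc m) (s≤s z≤n) ⟩
        1# * f + recip! 1 * D V f
          ≈⟨ +-cong (*-identityˡ f) (trans (*-congʳ (trans (sym (×-homo-1 _)) (recip!-suc 0))) (*-identityˡ _)) ⟩
        f + D V f                ∎

      -- Homogeneous maps with symmetric Jacobian matrix of vanishing cube.

      module NilpotentGradient
        (x h : Vector) (D-x : ∀ V i → D V (x i) ≈ V i) (sym-x : Symmetric x) (sym-h : Symmetric h)
        -- Here `d` is one less than the degree of homogeneity, so that the Euler factor is visibly
        -- a positive integer.
        (d : ℕ) (euler : ∀ i → D x (h i) ≈ suc d · h i)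
        (nilpotent : ∀ i j → sum (λ k → sum (λ l → ∂ i (h l) * ∂ l (h k)) * ∂ k (h j)) ≈ 0#)
        where

        b : Vector
        b i = D h (h i)

        -- Replacing `suc d · h i` by `D x (h i)` turns the sum into `x` paired with a zero vector,
        -- and `suc d` is then cancelled.
        euler-sum : ∀ (v : Vector) → (∀ k → sum (λ i → ∂ k (h i) * v i) ≈ 0#) → sum (λ i → h i * v i) ≈ 0#
        euler-sum v Av≈0 = ×-cancel d (begin
          suc d · sum (λ i → h i * v i)                    ≈⟨ ×-distrib-sum (suc d) (λ i → h i * v i) ⟩
          sum (λ i → suc d · (h i * v i))
            ≈⟨ ∑-cong (λ i → trans (sym (×-assoc-* (suc d) _ _)) (*-congʳ (sym (euler i)))) ⟩
          sum (λ i → D x (h i) * v i)                      ≈⟨ sum-*-assoc x (λ k i → ∂ k (h i)) v ⟩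
          sum (λ k → x k * sum (λ i → ∂ k (h i) * v i))
            ≈⟨ sum-zero (λ k → trans (*-congˡ (Av≈0 k)) (zeroʳ _)) ⟩
          0#                                               ∎)

        -- Unfolding `b` shows `h` paired with the i-th column of the squared Jacobian matrix. For
        -- that column the hypothesis of `euler-sum` is the vanishing of the cube.
        D-b-h : ∀ i → D b (h i) ≈ 0#
        D-b-h i = trans (sum-*-assoc h (λ l j → ∂ l (h j)) (λ j → ∂ j (h i)))
          (euler-sum _ λ k → trans (sym (sum-*-assoc (λ l → ∂ k (h l)) (λ l j → ∂ l (h j)) (λ j → ∂ j (h i)))) (nilpotent k i))

        Ab≈0 : ∀ i → sum (λ j → ∂ i (h j) * b j) ≈ 0#
        Ab≈0 i = trans (∑-cong λ j → trans (*-comm _ _) (*-congˡ (sym-h i j))) (D-b-h i)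

        -- By `sym-h`, `b j` equals the sum of `h k * ∂ j (h k)`, half of `∂ j` of ⟨h , h⟩. The
        -- right-hand side is thus half a Hessian, visibly symmetric in `i` and `j`.
        ∂-b : ∀ i j → ∂ i (b j) ≈ sum (λ k → ∂ i (h k) * ∂ j (h k)) + sum (λ k → h k * ∂ i (∂ j (h k)))
        ∂-b i j = trans (∂-cong i (∑-cong λ k → *-congˡ (sym-h k j))) (∂-sum-* i h (λ k → ∂ j (h k)))

        sym-b : Symmetric b
        sym-b i j = trans (∂-b i j) (trans
          (+-cong (∑-cong λ k → *-comm _ _) (∑-cong λ k → *-congˡ (∂-comm i j (h k))))
          (sym (∂-b j i)))

        D-h-b : ∀ i → D h (b i) ≈ 0#
        D-h-b i = begin
          D h (b i)
            ≈⟨ ∑-cong (λ j → *-congˡ (sym-b j i)) ⟩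
          sum (λ j → h j * ∂ i (b j))                                        ≈⟨ +-identityˡ _ ⟨
          0# + sum (λ j → h j * ∂ i (b j))                                   ≈⟨ +-congʳ (Ab≈0 i) ⟨
          sum (λ j → ∂ i (h j) * b j) + sum (λ j → h j * ∂ i (b j))          ≈⟨ ∂-sum-* i h b ⟨
          ∂ i (sum (λ j → h j * b j))                                        ≈⟨ ∂-cong i (euler-sum b Ab≈0) ⟩
          ∂ i 0#                                                             ≈⟨ ∂-0 i ⟩
          0#                                                                 ∎

        -- Unfolding one factor gives ⟨b , b⟩ = ⟨h , (JH) b⟩ = 0. The two halves of its gradient
        -- coincide by `sym-b`, so what vanishes at first is twice the claim; `×-cancel 1` divides
        -- by two.
        D-b-b : ∀ i → D b (b i) ≈ 0#
        D-b-b i = ×-cancel 1 (begin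
          D b (b i) + (D b (b i) + 0#)
            ≈⟨ +-cong Db≈ (trans (+-identityʳ _) (∑-cong (λ j → *-congˡ (sym-b j i)))) ⟩
          sum (λ j → ∂ i (b j) * b j) + sum (λ j → b j * ∂ i (b j))          ≈⟨ ∂-sum-* i b b ⟨
          ∂ i (sum (λ j → b j * b j))                                        ≈⟨ ∂-cong i b·b≈0 ⟩
          ∂ i 0#                                                             ≈⟨ ∂-0 i ⟩
          0#                                                                 ∎)
          where
          b·b≈0 : sum (λ j → b j * b j) ≈ 0#
          b·b≈0 = trans (sum-*-assoc h (λ k j → ∂ k (h j)) b)
            (sum-zero λ k → trans (*-congˡ (Ab≈0 k)) (zeroʳ _))
          Db≈ : D b (b i) ≈ sum (λ j → ∂ i (b j) * b j)
          Db≈ = ∑-cong λ j → trans (*-comm _ _) (*-congʳ (sym-b j i))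

        f g : Vector
        f i = x i - h i
        g i = x i + h i + b i

        sym-f : Symmetric f
        sym-f = symmetric-+ sym-x λ i j → trans (∂-neg i _) (trans (-‿cong (sym-h i j)) (sym (∂-neg j _)))

        sym-g : Symmetric g
        sym-g = symmetric-+ (symmetric-+ sym-x sym-h) sym-b

        -h h+b : Vector
        -h i = - h i
        h+b i = h i + b i

        D-g : ∀ V i → D V (g i) ≈ V i + D V (h i) + D V (b i)
        D-g V i = trans (D-+ V _ _) (+-congʳ (trans (D-+ V _ _) (+-congʳ (D-x V i))))

        D-f : ∀ V i → D V (f i) ≈ V i - D V (h i)
        D-f V i = trans (D-+ V _ _) (+-cong (D-x V i) (D-neg V _))

        D²-from : ∀ V {y v} → D V (D V y) ≈ v → D (D V ∘ V) y ≈ v → Dᶠ 2 V y ≈ 0#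
        D²-from V {y} {v} p q = identityʳ-unique v _ (begin
          v + Dᶠ 2 V y              ≈⟨ +-comm _ _ ⟩
          Dᶠ 2 V y + v              ≈⟨ +-congˡ q ⟨
          Dᶠ 2 V y + D (D V ∘ V) y  ≈⟨ D∘D V y ⟨
          D V (D V y)               ≈⟨ p ⟩
          v                         ∎)

        neg-neg : ∀ y → - - y ≈ y
        neg-neg = RingProperties.-‿involutive ring

        D-h-g : ∀ i → D -h (g i) ≈ - h i - b i
        D-h-g i = begin
          D -h (g i)                          ≈⟨ D-g -h i ⟩
          - h i + D -h (h i) + D -h (b i)
            ≈⟨ +-cong (+-congˡ (D-negˡ h (h i))) (trans (D-negˡ h (b i)) (trans (-‿cong (D-h-b i)) -0#≈0#)) ⟩
          - h i - b i + 0#                    ≈⟨ +-identityʳ _ ⟩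
          - h i - b i                         ∎

        D²-h-g : ∀ i → Dᶠ 2 -h (g i) ≈ 0#
        D²-h-g i = D²-from -h {v = b i}
          (begin
            D -h (D -h (g i))                 ≈⟨ D-cong (λ _ → refl) (D-h-g i) ⟩
            D -h (- h i - b i)                ≈⟨ D-+ -h _ _ ⟩
            D -h (- h i) + D -h (- b i)       ≈⟨ +-cong (D-negneg (h i)) (trans (D-negneg (b i)) (D-h-b i)) ⟩
            b i + 0#                          ≈⟨ +-identityʳ _ ⟩
            b i                               ∎)
          (begin
            D (D -h ∘ -h) (g i)               ≈⟨ D-cong (λ j → D-negneg (h j)) refl ⟩
            D b (g i)                         ≈⟨ D-g b i ⟩
            b i + D b (h i) + D b (b i)       ≈⟨ +-cong (+-congˡ (D-b-h i)) (D-b-b i) ⟩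
            b i + 0# + 0#                     ≈⟨ trans (+-identityʳ _) (+-identityʳ _) ⟩
            b i                               ∎)
          where
          D-negneg : ∀ y → D -h (- y) ≈ D h y
          D-negneg y = trans (D-negˡ h _) (trans (-‿cong (D-neg h y)) (neg-neg _))

        D-hb-h : ∀ i → D h+b (h i) ≈ b i
        D-hb-h i = trans (D-+ˡ h b _) (trans (+-congˡ (D-b-h i)) (+-identityʳ _))

        D-hb-b : ∀ i → D h+b (b i) ≈ 0#
        D-hb-b i = trans (D-+ˡ h b _) (trans (+-cong (D-h-b i) (D-b-b i)) (+-identityʳ _))

        D-hb-f : ∀ i → D h+b (f i) ≈ h i
        D-hb-f i = begin
          D h+b (f i)                 ≈⟨ D-f h+b i ⟩
          h i + b i - D h+b (h i)     ≈⟨ +-congˡ (-‿cong (D-hb-h i)) ⟩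
          h i + b i - b i             ≈⟨ +-assoc _ _ _ ⟩
          h i + (b i - b i)           ≈⟨ +-congˡ (-‿inverseʳ _) ⟩
          h i + 0#                    ≈⟨ +-identityʳ _ ⟩
          h i                         ∎

        D²-hb-f : ∀ i → Dᶠ 2 h+b (f i) ≈ 0#
        D²-hb-f i = D²-from h+b {v = b i}
          (trans (D-cong (λ _ → refl) (D-hb-f i)) (D-hb-h i))
          (begin
            D (D h+b ∘ h+b) (f i)
              ≈⟨ D-cong (λ j → trans (D-+ h+b _ _) (trans (+-cong (D-hb-h j) (D-hb-b j)) (+-identityʳ _))) refl ⟩
            D b (f i)                   ≈⟨ D-f b i ⟩
            b i - D b (h i)             ≈⟨ +-congˡ (trans (-‿cong (D-b-h i)) -0#≈0#) ⟩
            b i + 0#                    ≈⟨ +-identityʳ _ ⟩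
            b i                         ∎)

        -- Since `f` is `x` displaced by `-h`, the Taylor sum of `g i` along `-h` is the composite
        -- of `g i` with `f`. Likewise `h+b` displaces `x` to `g` in `f∘g`.
        g∘f : ∀ {i s} → HasTaylorSum -h (g i) s → s ≈ x i
        g∘f {i} {s} p = begin
          s                                     ≈⟨ taylorSum-first-order -h (λ k → Dᶠ-vanishes-from-2 -h sym-g D²-h-g k i) p ⟩
          g i + D -h (g i)                      ≈⟨ +-congˡ (trans (D-h-g i) (-‿+-comm _ _)) ⟩
          x i + h i + b i - (h i + b i)         ≈⟨ +-congʳ (+-assoc _ _ _) ⟩
          x i + (h i + b i) - (h i + b i)       ≈⟨ +-assoc _ _ _ ⟩
          x i + ((h i + b i) - (h i + b i))     ≈⟨ +-congˡ (-‿inverseʳ _) ⟩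
          x i + 0#                              ≈⟨ +-identityʳ _ ⟩
          x i                                   ∎

        f∘g : ∀ {i s} → HasTaylorSum h+b (f i) s → s ≈ x i
        f∘g {i} {s} p = begin
          s                                     ≈⟨ taylorSum-first-order h+b (λ k → Dᶠ-vanishes-from-2 h+b sym-f D²-hb-f k i) p ⟩
          f i + D h+b (f i)                     ≈⟨ +-congˡ (D-hb-f i) ⟩
          x i - h i + h i                       ≈⟨ +-assoc _ _ _ ⟩
          x i + (- h i + h i)                   ≈⟨ +-congˡ (-‿inverseˡ _) ⟩
          x i + 0#                              ≈⟨ +-identityʳ _ ⟩
          x i                                   ∎

-- Monomials, substitution, homogeneity and Euler's identity.

module Monomials {c ℓ} (K : CommutativeRing c ℓ) where
  open PolynomialMaps K using (Series; Σ□; ∂; DegreeAtMost; substituteUpTo)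
  open PolynomialMaps K using () renaming (_*_ to _*ˢ_; sum to sumˢ; product to productˢ; _^_ to _^ˢ_)
  open SeriesRing K
  open CommutativeRing K hiding (zero)
  open SemiringMult semiring using (×-homo-+) renaming (_×_ to _·_)
  open CommutativeMonoidSum +-commutativeMonoid using (sum; sum-cong-≋; sum-replicate-zero; ∑-distrib-+)
  open SetoidReasoning setoid

  sum-select : ∀ c D (h : ℕ → Carrier) → c ≤ D → (∀ a → a ≢ c → h a ≈ 0#) →
    sum {suc D} (λ i → h (toℕ i)) ≈ h c
  sum-select zero D h _ h≈0 = trans
    (+-congˡ (trans (sum-cong-≋ {D} λ i → h≈0 (suc (toℕ i)) λ ()) (sum-replicate-zero D)))
    (+-identityʳ _)
  sum-select (suc c) (suc D) h (s≤s c≤D) h≈0 = trans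
    (+-cong (h≈0 0 λ ()) (sum-select c D (h ∘ suc) c≤D λ a a≢c → h≈0 (suc a) (a≢c ∘ ℕ.suc-injective)))
    (+-identityˡ _)

  Σ□-zero : ∀ {n} (δ : Exponent n) {g : Series n} → (∀ α → g α ≈ 0#) → Σ□ δ g ≈ 0#
  Σ□-zero []      g≈0 = g≈0 []
  Σ□-zero (a ∷ δ) g≈0 = trans (sum-cong-≋ {suc a} λ i → Σ□-zero δ λ β → g≈0 (toℕ i ∷ β)) (sum-replicate-zero (suc a))

  Σ□-+ : ∀ {n} (δ : Exponent n) (f g : Series n) → Σ□ δ (f +ˢ g) ≈ Σ□ δ f + Σ□ δ g
  Σ□-+ []      f g = refl
  Σ□-+ (a ∷ δ) f g = trans (sum-cong-≋ {suc a} λ i → Σ□-+ δ (curry f (toℕ i)) (curry g (toℕ i)))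
    (∑-distrib-+ {suc a} (λ i → Σ□ δ (curry f (toℕ i))) (λ i → Σ□ δ (curry g (toℕ i))))

  Σ□-select : ∀ {n} D (γ : Exponent n) (g : Series n) → degree γ ≤ D → (∀ α → α ≢ γ → g α ≈ 0#) →
    Σ□ (replicate n D) g ≈ g γ
  Σ□-select D []      g γ≤D g≈0 = refl
  Σ□-select {suc n} D (c ∷ γ) g γ≤D g≈0 = trans
    (sum-select c D (λ a → Σ□ (replicate n D) (curry g a)) (ℕ.m+n≤o⇒m≤o c γ≤D)
      λ a a≢c → Σ□-zero (replicate n D) λ α → g≈0 (a ∷ α) λ { ≡.refl → a≢c ≡.refl })
    (Σ□-select D γ (curry g c) (ℕ.m+n≤o⇒n≤o c γ≤D) λ α α≢γ → g≈0 (c ∷ α) λ { ≡.refl → α≢γ ≡.refl })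

  -- In a product of series only exponents of complementary degrees meet.
  Σ□-cong-degree : ∀ {n} (γ : Exponent n) {f g : Series n} →
    (∀ β → degree β ℕ.+ degree (zipWith _∸_ γ β) ≡ degree γ → f β ≈ g β) → Σ□ γ f ≈ Σ□ γ g
  Σ□-cong-degree []      f≈g = f≈g [] ≡.refl
  Σ□-cong-degree (c ∷ γ) f≈g = sum-cong-≋ {suc c} λ i → Σ□-cong-degree γ λ β eq → f≈g (toℕ i ∷ β)
    (≡.trans (interchange (toℕ i) (degree β) (c ∸ toℕ i) _)
      (≡.cong₂ ℕ._+_ (ℕ.m+[n∸m]≡n (Fin.toℕ≤pred[n] i)) eq))
    where open CommutativeSemigroupProperties ℕ.+-commutativeSemigroup using (interchange)

  ^-congˢ : ∀ {n} a {f g : Series n} → f ≈ˢ g → f ^ˢ a ≈ˢ g ^ˢ a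
  ^-congˢ zero    f≈g = λ _ → refl
  ^-congˢ (suc a) f≈g = *-congˢ f≈g (^-congˢ a f≈g)

  product-congˢ : ∀ {n m} {s t : Fin m → Series n} → (∀ i → s i ≈ˢ t i) → productˢ s ≈ˢ productˢ t
  product-congˢ {m = zero}  s≈t = λ _ → refl
  product-congˢ {m = suc m} s≈t = *-congˢ (s≈t zero) (product-congˢ (s≈t ∘ suc))

  lift-homo-* : ∀ {n} (f g : Series n) → lift f *ˢ lift g ≈ˢ lift (f *ˢ g)
  lift-homo-* f g (zero  ∷ α) = lift-* f (lift g) 0 α
  lift-homo-* f g (suc a ∷ α) = trans (lift-* f (lift g) (suc a) α) (CommutativeRing.zeroʳ (seriesRing _) f α)

  lift-homo-^ : ∀ {n} (f : Series n) a → lift f ^ˢ a ≈ˢ lift (f ^ˢ a)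
  lift-homo-^ f zero    α = sym (lift-1 α)
  lift-homo-^ f (suc a) α = trans (*-congˢ {x = lift f} (λ _ → refl) (lift-homo-^ f a) α) (lift-homo-* f (f ^ˢ a) α)

  lift-homo-product : ∀ {n m} (t : Fin m → Series n) → productˢ (lift ∘ t) ≈ˢ lift (productˢ t)
  lift-homo-product {m = zero}  t α = sym (lift-1 α)
  lift-homo-product {m = suc m} t α = trans (*-congˢ {x = lift (t zero)} (λ _ → refl) (lift-homo-product (t ∘ suc)) α)
    (lift-homo-* (t zero) _ α)

  x-zero-^-zero : ∀ {n} a (g : Series n) α → ((x zero ^ˢ suc a) *ˢ lift g) (zero ∷ α) ≈ 0#
  x-zero-^-zero a g α = trans (*-assocˢ (x zero) (x zero ^ˢ a) (lift g) (zero ∷ α))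
    (x-zero-*-zero ((x zero ^ˢ a) *ˢ lift g) α)

  x-zero-^-suc : ∀ {n} a (g : Series n) b α →
    ((x zero ^ˢ suc a) *ˢ lift g) (suc b ∷ α) ≈ ((x zero ^ˢ a) *ˢ lift g) (b ∷ α)
  x-zero-^-suc a g b α = trans (*-assocˢ (x zero) (x zero ^ˢ a) (lift g) (suc b ∷ α))
    (x-zero-*-suc ((x zero ^ˢ a) *ˢ lift g) b α)

  x-zero-^-same : ∀ {n} a (g : Series n) α → ((x zero ^ˢ a) *ˢ lift g) (a ∷ α) ≈ g α
  x-zero-^-same zero    g α = *-identityˡˢ (lift g) (zero ∷ α)
  x-zero-^-same (suc a) g α = trans (x-zero-^-suc a g a α) (x-zero-^-same a g α)

  x-zero-^-distinct : ∀ {n} a (g : Series n) b α → a ≢ b → ((x zero ^ˢ a) *ˢ lift g) (b ∷ α) ≈ 0#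
  x-zero-^-distinct zero    g zero    α a≢b = contradiction ≡.refl a≢b
  x-zero-^-distinct zero    g (suc b) α a≢b = *-identityˡˢ (lift g) (suc b ∷ α)
  x-zero-^-distinct (suc a) g zero    α a≢b = x-zero-^-zero a g α
  x-zero-^-distinct (suc a) g (suc b) α a≢b = trans (x-zero-^-suc a g b α)
    (x-zero-^-distinct a g b α (a≢b ∘ ≡.cong suc))

  power : ∀ {n m} → (Fin m → Series n) → Exponent m → Series n
  power U α = productˢ λ i → U i ^ˢ lookup α i

  power-x-∷ : ∀ {n} a (α : Exponent n) → power x (a ∷ α) ≈ˢ ((x zero ^ˢ a) *ˢ lift (power x α))
  power-x-∷ a α = *-congˢ {x = x zero ^ˢ a} (λ _ → refl) λ β → trans
    (product-congˢ (λ i γ → trans (^-congˢ (lookup α i) (x-suc i) γ) (lift-homo-^ (x i) (lookup α i) γ)) β)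
    (lift-homo-product (λ i → x i ^ˢ lookup α i) β)

  power-x-same : ∀ {n} (α : Exponent n) → power x α α ≈ 1#
  power-x-same []      = refl
  power-x-same (a ∷ α) = trans (power-x-∷ a α (a ∷ α)) (trans (x-zero-^-same a (power x α) α) (power-x-same α))

  power-x-distinct : ∀ {n} (α γ : Exponent n) → α ≢ γ → power x α γ ≈ 0#
  power-x-distinct []      []      α≢γ = contradiction ≡.refl α≢γ
  power-x-distinct (a ∷ α) (c ∷ γ) α≢γ with a ℕ.≟ c
  ... | yes ≡.refl = trans (power-x-∷ a α (a ∷ γ)) (trans (x-zero-^-same a (power x α) γ)
        (power-x-distinct α γ (α≢γ ∘ ≡.cong (a ∷_))))
  ... | no a≢c     = trans (power-x-∷ a α (c ∷ γ)) (x-zero-^-distinct a (power x α) c γ a≢c)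

  -- Exhibits a polynomial as the combination of its monomials: the coefficients of `power x α` are
  -- 1 at `α` and 0 elsewhere. Taylor's formula is thereby reduced to monomials.
  substitute-x : ∀ {n} D (f : Series n) → DegreeAtMost D f → substituteUpTo D f x ≈ˢ f
  substitute-x {n} D f f≤D γ with degree γ ℕ.≤? D
  ... | yes γ≤D = trans (Σ□-select D γ (λ α → f α * power x α γ) γ≤D λ α α≢γ →
          trans (*-congˡ (power-x-distinct α γ α≢γ)) (zeroʳ _))
        (trans (*-congˡ (power-x-same γ)) (*-identityʳ _))
  -- The box also contains exponents of degree above `D`, so `γ` may still lie in it; hence the term
  -- at `γ` is killed by its coefficient and the other terms by their monomials.
  ... | no γ≰D = trans (Σ□-zero (replicate n D) vanish) (sym fγ≈0)
    where
    fγ≈0 : f γ ≈ 0#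
    fγ≈0 = f≤D γ (ℕ.≰⇒> γ≰D)
    vanish : ∀ α → f α * power x α γ ≈ 0#
    vanish α with ≡-dec ℕ._≟_ α γ
    ... | yes ≡.refl = trans (*-congʳ fγ≈0) (zeroˡ _)
    ... | no α≢γ     = trans (*-congˡ (power-x-distinct α γ α≢γ)) (zeroʳ _)

  power-0 : ∀ {n m} (U : Fin m → Series n) → power U (replicate m 0) ≈ˢ 1ˢ
  power-0 {m = zero}  U α = refl
  power-0 {m = suc m} U α = trans (*-identityˡˢ (power (U ∘ suc) (replicate m 0)) α) (power-0 (U ∘ suc) α)

  power-unit : ∀ {n m} (U : Fin m → Series n) i → power U (unit i) ≈ˢ U i
  power-unit U zero    α = trans (*-congˢ (*-identityʳˢ (U zero)) (power-0 (U ∘ suc)) α) (*-identityʳˢ (U zero) α)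
  power-unit U (suc i) α = trans (*-identityˡˢ (power (U ∘ suc) (unit i)) α) (power-unit (U ∘ suc) i α)

  x-unit : ∀ {n} (i : Fin n) → x i (unit i) ≈ 1#
  x-unit i = reflexive (≡.cong (if_then 1# else 0#) (dec-true (≡-dec ℕ._≟_ (unit i) (unit i)) ≡.refl))

  x-distinct : ∀ {n} (i : Fin n) α → α ≢ unit i → x i α ≈ 0#
  x-distinct i α α≢i = reflexive (≡.cong (if_then 1# else 0#) (dec-false (≡-dec ℕ._≟_ α (unit i)) α≢i))

  -- `Homogeneous` for bare series, since the derivatives and products to which it is applied come
  -- without a degree bound.
  HomogeneousOf : ∀ {n} → ℕ → Series n → Set ℓ
  HomogeneousOf d f = ∀ α → degree α ≢ d → f α ≈ 0#

  x-homogeneous : ∀ {n} (i : Fin n) → HomogeneousOf 1 (x i)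
  x-homogeneous i α α≢1 = x-distinct i α λ { ≡.refl → α≢1 (degree-unit i) }

  substitute-unit : ∀ {n} D → 1 ≤ D → ∀ i (U : Fin n → Series n) γ →
    Σ□ (replicate n D) (λ α → x i α * power U α γ) ≈ U i γ
  substitute-unit D 1≤D i U γ = trans
    (Σ□-select D (unit i) (λ α → x i α * power U α γ) (≡.subst (_≤ D) (≡.sym (degree-unit i)) 1≤D)
      λ α α≢i → trans (*-congʳ (x-distinct i α α≢i)) (zeroˡ _))
    (trans (*-cong (x-unit i) (power-unit U i γ)) (*-identityˡ _))

  degree-%=suc : ∀ {n} (α : Exponent n) i → degree (α [ i ]%= suc) ≡ suc (degree α)
  degree-%=suc (a ∷ α) zero    = ≡.refl
  degree-%=suc (a ∷ α) (suc i) = ≡.trans (≡.cong (a ℕ.+_) (degree-%=suc α i)) (ℕ.+-suc a (degree α))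

  ∂-homogeneous : ∀ {n d} (i : Fin n) {f} → HomogeneousOf (suc d) f → HomogeneousOf d (∂ i f)
  ∂-homogeneous i hom α α≢d = trans
    (×-congʳ (suc (lookup α i)) (hom _ (λ eq → α≢d (ℕ.suc-injective (≡.trans (≡.sym (degree-%=suc α i)) eq)))))
    (×-zeroʳ +-monoid (suc (lookup α i)))
    where open CommutativeMonoidMult +-commutativeMonoid using (×-congʳ)

  *-homogeneous : ∀ {n p q} {f g : Series n} → HomogeneousOf p f → HomogeneousOf q g →
    HomogeneousOf (p ℕ.+ q) (f *ˢ g)
  *-homogeneous {n} {p} {q} {f} {g} hf hg γ γ≢p+q = trans (Σ□-cong-degree γ vanish) (Σ□-zero γ λ _ → refl)
    where
    vanish : ∀ β → degree β ℕ.+ degree (zipWith _∸_ γ β) ≡ degree γ → f β * g (zipWith _∸_ γ β) ≈ 0#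
    vanish β eq with degree β ℕ.≟ p
    ... | no β≢p = trans (*-congʳ (hf β β≢p)) (zeroˡ _)
    ... | yes β≡p = trans (*-congˡ (hg _ λ q≡ → γ≢p+q (≡.trans (≡.sym eq) (≡.cong₂ ℕ._+_ β≡p q≡)))) (zeroʳ _)

  sum-homogeneous : ∀ {n p m} (t : Fin m → Series n) → (∀ i → HomogeneousOf p (t i)) → HomogeneousOf p (sumˢ t)
  sum-homogeneous {m = m} t hom α α≢p = trans (reflexive (sumˢ-at t α))
    (trans (sum-cong-≋ {m} λ i → hom i α α≢p) (sum-replicate-zero m))

  -- The operator x_i ∂_i is diagonal on monomials with the i-th exponent as eigenvalue. Euler's
  -- identity follows because these eigenvalues add up to the degree.
  x-*-∂ : ∀ {n} (i : Fin n) f α → (x i *ˢ ∂ i f) α ≈ lookup α i · f α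
  x-*-∂ zero    f (zero  ∷ α) = x-zero-*-zero (∂ zero f) α
  x-*-∂ zero    f (suc a ∷ α) = x-zero-*-suc (∂ zero f) a α
  x-*-∂ (suc i) f (a ∷ α) = trans (*-congˢ {u = ∂ (suc i) f} (x-suc i) (λ _ → refl) (a ∷ α))
    (trans (lift-* (x i) (∂ (suc i) f) a α) (x-*-∂ i (curry f a) α))

  sum-lookup-· : ∀ {n} (α : Exponent n) y → sum (λ i → lookup α i · y) ≈ degree α · y
  sum-lookup-· []      y = refl
  sum-lookup-· (a ∷ α) y = trans (+-congˡ (sum-lookup-· α y)) (sym (×-homo-+ y a (degree α)))

  euler : ∀ {n d} {f : Series n} → HomogeneousOf d f → sumˢ (λ i → x i *ˢ ∂ i f) ≈ˢ d ·ˢ f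
  euler {n} {d} {f} hom α = begin
    sumˢ (λ i → x i *ˢ ∂ i f) α        ≡⟨ sumˢ-at (λ i → x i *ˢ ∂ i f) α ⟩
    sum (λ i → (x i *ˢ ∂ i f) α)       ≈⟨ sum-cong-≋ {n} (λ i → x-*-∂ i f α) ⟩
    sum (λ i → lookup α i · f α)       ≈⟨ sum-lookup-· α (f α) ⟩
    degree α · f α                     ≈⟨ by-degree ⟩
    d · f α                            ≡⟨ ·ˢ-at d f α ⟨
    (d ·ˢ f) α                         ∎
    where
    open CommutativeMonoidMult +-commutativeMonoid using (×-congʳ)
    by-degree : degree α · f α ≈ d · f α
    by-degree with degree α ℕ.≟ d
    ... | yes eq = reflexive (≡.cong (_· f α) eq)
    ... | no α≢d = trans (trans (×-congʳ (degree α) (hom α α≢d)) (×-zeroʳ +-monoid (degree α)))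
                         (sym (trans (×-congʳ d (hom α α≢d)) (×-zeroʳ +-monoid d)))

-- Uniqueness of the right inverse, degree by degree.

module Graded {c ℓ} (K : CommutativeRing c ℓ) where
  open PolynomialMaps K using (Series; Σ□; substituteUpTo)
  open PolynomialMaps K using () renaming (_*_ to _*ˢ_; _^_ to _^ˢ_)
  open SeriesRing K
  open Monomials K
  open CommutativeRing K hiding (zero)
  open SetoidReasoning setoid
  open GroupProperties +-group using () renaming (∙-cancelʳ to +-cancelʳ)

  VanishesBelow : ∀ {n} → ℕ → Series n → Set ℓ
  VanishesBelow k f = ∀ α → degree α < k → f α ≈ 0#

  -- The precision `m` is measured relative to the order `k`. In this form products keep the
  -- precision and add the orders.
  record Close {n} (m k : ℕ) (f g : Series n) : Set ℓ where
    field
      vanishesˡ : VanishesBelow k f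
      vanishesʳ : VanishesBelow k g
      agree     : ∀ α → degree α < m ℕ.+ k → f α ≈ g α
  open Close

  vanishes-* : ∀ {n k l} {f g : Series n} → VanishesBelow k f → VanishesBelow l g → VanishesBelow (k ℕ.+ l) (f *ˢ g)
  vanishes-* {k = k} {l} {f} {g} vf vg γ γ<k+l = trans (Σ□-cong-degree γ term) (Σ□-zero γ λ _ → refl)
    where
    term : ∀ β → degree β ℕ.+ degree (zipWith _∸_ γ β) ≡ degree γ → f β * g (zipWith _∸_ γ β) ≈ 0#
    term β eq with degree β ℕ.<? k
    ... | yes β<k = trans (*-congʳ (vf β β<k)) (zeroˡ _)
    ... | no β≮k = trans (*-congˡ (vg _ (ℕ.+-cancelˡ-< k _ _ (ℕ.≤-<-trans (ℕ.+-monoˡ-≤ _ (ℕ.≮⇒≥ β≮k))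
                     (≡.subst (_< k ℕ.+ l) (≡.sym eq) γ<k+l))))) (zeroʳ _)

  -- If one of two complementary exponents lies beyond the range of agreement, the other lies below
  -- the order of vanishing, so both products are zero there.
  close-* : ∀ {n m k l} {f f′ g g′ : Series n} → Close m k f f′ → Close m l g g′ →
    Close m (k ℕ.+ l) (f *ˢ g) (f′ *ˢ g′)
  close-* {n} {m} {k} {l} {f} {f′} {g} {g′} F G = record
    { vanishesˡ = vanishes-* (vanishesˡ F) (vanishesˡ G)
    ; vanishesʳ = vanishes-* (vanishesʳ F) (vanishesʳ G)
    ; agree     = λ γ γ< → Σ□-cong-degree γ λ β eq →
        term β (zipWith _∸_ γ β) (≡.subst (_< m ℕ.+ (k ℕ.+ l)) (≡.sym eq) γ<)
    }
    where
    open CommutativeSemigroupProperties ℕ.+-commutativeSemigroup using (x∙yz≈y∙xz)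
    bound : ∀ {p q r s} → p ℕ.+ q < r ℕ.+ s → r ≤ p → q < s
    bound {p} {q} {r} {s} lt r≤p = ℕ.+-cancelˡ-< r q s (ℕ.≤-<-trans (ℕ.+-monoˡ-≤ q r≤p) lt)
    term : ∀ β β′ → degree β ℕ.+ degree β′ < m ℕ.+ (k ℕ.+ l) → f β * g β′ ≈ f′ β * g′ β′
    term β β′ lt with degree β ℕ.<? m ℕ.+ k | degree β′ ℕ.<? m ℕ.+ l
    ... | yes p | yes q = *-cong (agree F β p) (agree G β′ q)
    ... | no p  | _     = trans (trans (*-congˡ (vanishesˡ G β′ β′<l)) (zeroʳ _))
                           (sym (trans (*-congˡ (vanishesʳ G β′ β′<l)) (zeroʳ _)))
      where
      β′<l : degree β′ < l
      β′<l = bound (≡.subst (degree β ℕ.+ degree β′ <_) (≡.sym (ℕ.+-assoc m k l)) lt) (ℕ.≮⇒≥ p)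
    ... | yes _ | no q  = trans (trans (*-congʳ (vanishesˡ F β β<k)) (zeroˡ _))
                           (sym (trans (*-congʳ (vanishesʳ F β β<k)) (zeroˡ _)))
      where
      β<k : degree β < k
      β<k = bound (≡.subst₂ _<_ (ℕ.+-comm (degree β) (degree β′))
        (≡.trans (x∙yz≈y∙xz m k l) (ℕ.+-comm k (m ℕ.+ l))) lt) (ℕ.≮⇒≥ q)

  close-1 : ∀ {n m} → Close m 0 (1ˢ {n}) 1ˢ
  close-1 = record { vanishesˡ = λ _ () ; vanishesʳ = λ _ () ; agree = λ _ _ → refl }

  close-^ : ∀ {n m} a {f g : Series n} → Close m 1 f g → Close m a (f ^ˢ a) (g ^ˢ a)
  close-^ zero    F = close-1
  close-^ (suc a) F = close-* F (close-^ a F)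

  close-power : ∀ {n m p} {U V : Fin p → Series n} → (∀ i → Close m 1 (U i) (V i)) →
    ∀ α → Close m (degree α) (power U α) (power V α)
  close-power UV []      = close-1
  close-power UV (a ∷ α) = close-* (close-^ a (UV zero)) (close-power (UV ∘ suc) α)

  -- F = X + h with h homogeneous of degree ≥ 2: the coefficients of a right
  -- inverse in degree m are determined by those in lower degrees.
  rightInverse-unique : ∀ {n d} → 2 ≤ d → (h : Fin n → Series n) → (∀ i → HomogeneousOf d (h i)) →
    (D : Fin n → ℕ) → (∀ i → 1 ≤ D i) → (G G′ : Fin n → Series n) →
    (∀ i → VanishesBelow 1 (G i)) → (∀ i → VanishesBelow 1 (G′ i)) →
    (∀ i → substituteUpTo (D i) (x i +ˢ h i) G ≈ˢ substituteUpTo (D i) (x i +ˢ h i) G′) →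
    ∀ i → G i ≈ˢ G′ i
  rightInverse-unique {n} {d} 2≤d h hom D 1≤D G G′ vG vG′ F∘G≈F∘G′ i α =
    agree (close (degree α) i) α (ℕ.≤-reflexive (ℕ.+-comm 1 (degree α)))
    where
    linear : ∀ i (U : Fin n → Series n) γ →
      substituteUpTo (D i) (x i +ˢ h i) U γ ≈ U i γ + substituteUpTo (D i) (h i) U γ
    linear i U γ = begin
      Σ□ (replicate n (D i)) (λ α → (x i α + h i α) * power U α γ)
        ≈⟨ Σ□-cong (replicate n (D i)) (λ α → distribʳ _ _ _) ⟩
      Σ□ (replicate n (D i)) (λ α → x i α * power U α γ + h i α * power U α γ)
        ≈⟨ Σ□-+ (replicate n (D i)) (λ α → x i α * power U α γ) (λ α → h i α * power U α γ) ⟩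
      Σ□ (replicate n (D i)) (λ α → x i α * power U α γ) + substituteUpTo (D i) (h i) U γ
        ≈⟨ +-congʳ (substitute-unit (D i) (1≤D i) i U γ) ⟩
      U i γ + substituteUpTo (D i) (h i) U γ ∎

    close : ∀ m i → Close m 1 (G i) (G′ i)
    close zero    i = record
      { vanishesˡ = vG i
      ; vanishesʳ = vG′ i
      ; agree     = λ α α<1 → trans (vG i α α<1) (sym (vG′ i α α<1))
      }
    close (suc m) i = record { vanishesˡ = vG i ; vanishesʳ = vG′ i ; agree = step }
      where
      step : ∀ γ → degree γ < suc m ℕ.+ 1 → G i γ ≈ G′ i γ
      step γ γ<m+2 = +-cancelʳ (substituteUpTo (D i) (h i) G γ) _ _ (begin
        G i γ + substituteUpTo (D i) (h i) G γ      ≈⟨ linear i G γ ⟨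
        substituteUpTo (D i) (x i +ˢ h i) G γ       ≈⟨ F∘G≈F∘G′ i γ ⟩
        substituteUpTo (D i) (x i +ˢ h i) G′ γ      ≈⟨ linear i G′ γ ⟩
        G′ i γ + substituteUpTo (D i) (h i) G′ γ    ≈⟨ +-congˡ (Σ□-cong (replicate n (D i)) term) ⟨
        G′ i γ + substituteUpTo (D i) (h i) G γ     ∎)
        where
        term : ∀ α → h i α * power G α γ ≈ h i α * power G′ α γ
        term α with degree α ℕ.≟ d
        -- A monomial of degree d in series known to relative precision `m` is known in all degrees
        -- below m + d. As d ≥ 2 this includes degree m + 1, the gain that drives the induction.
        ... | yes ≡.refl = *-congˡ (agree (close-power (close m) α) γ
              (ℕ.<-≤-trans γ<m+2 (≡.subst (_≤ m ℕ.+ degree α) (ℕ.+-suc m 1) (ℕ.+-monoʳ-≤ m 2≤d))))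
        ... | no α≢d = trans (trans (*-congʳ (hom i α α≢d)) (zeroˡ _)) (sym (trans (*-congʳ (hom i α α≢d)) (zeroˡ _)))

-- Reciprocals of positive integers in a ℚ-algebra.

module Reciprocals {c ℓ} {K : CommutativeRing c ℓ} (A : ℚ-Algebra K) where
  open CommutativeRing K hiding (zero)
  open ℚ-Algebra A
  open IsRingHomomorphism isRingHomomorphism
  open SemiringMult semiring using () renaming (_×_ to _·_)
  private module ℚ× = SemiringMult (CommutativeRing.semiring ℚ.+-*-commutativeRing)

  fromℚ-× : ∀ k q → fromℚ (k ℚ×.× q) ≈ k · fromℚ q
  fromℚ-× zero    q = 0#-homo
  fromℚ-× (suc k) q = trans (+-homo q (k ℚ×.× q)) (+-congˡ (fromℚ-× k q))

  0≤k×1 : ∀ k → ℚ.0ℚ ℚ.≤ k ℚ×.× ℚ.1ℚ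
  0≤k×1 zero    = ℚ.≤-refl
  0≤k×1 (suc k) = ℚ.+-mono-≤ {ℚ.0ℚ} {ℚ.1ℚ} (ℚ.nonNegative⁻¹ ℚ.1ℚ) (0≤k×1 k)

  0<1+k×1 : ∀ k → ℚ.0ℚ ℚ.< suc k ℚ×.× ℚ.1ℚ
  0<1+k×1 k = ℚ.+-mono-<-≤ {ℚ.0ℚ} {ℚ.1ℚ} (ℚ.positive⁻¹ ℚ.1ℚ) (0≤k×1 k)

  1+k≢0 : ∀ k → ℚ.NonZero (suc k ℚ×.× ℚ.1ℚ)
  1+k≢0 k = ℚ.>-nonZero (0<1+k×1 k)

  -- The integer is formed as a repeated sum of `ℚ.1ℚ`, so that additivity of `fromℚ` turns its
  -- multiples into multiples in `K`.
  reciprocal : ℕ → Carrier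
  reciprocal k = fromℚ (ℚ.1/_ (suc k ℚ×.× ℚ.1ℚ) {{1+k≢0 k}})

  reciprocal-inverse : ∀ k → suc k · reciprocal k ≈ 1#
  reciprocal-inverse k = trans (sym (fromℚ-× (suc k) q)) (trans (⟦⟧-cong eq) 1#-homo)
    where
    p q : ℚ
    p = suc k ℚ×.× ℚ.1ℚ
    q = ℚ.1/_ p {{1+k≢0 k}}
    eq : suc k ℚ×.× q ≡ ℚ.1ℚ
    eq = ≡.trans (≡.cong (suc k ℚ×.×_) (≡.sym (ℚ.*-identityˡ q)))
      (≡.trans (≡.sym (ℚ×.×-assoc-* (suc k) ℚ.1ℚ q)) (ℚ.*-inverseʳ p {{1+k≢0 k}}))

-- Taylor's formula for substitution into polynomials.

module Taylor {c ℓ} {K : CommutativeRing c ℓ} (A : ℚ-Algebra K) (n : ℕ) where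
  open PolynomialMaps K using (Series; Σ□; DegreeAtMost; substituteUpTo; ∂)
  open PolynomialMaps K using () renaming (_*_ to _*ˢ_; sum to sumˢ; _^_ to _^ˢ_)
  open SeriesRing K
  open Monomials K
  open Reciprocals A
  open DifferentialRing.Derivations (seriesRing n) ∂ ∂-cong ∂-+ ∂-* ∂-comm public
  open WithReciprocals (constant ∘ reciprocal) (λ k → ·-constant (suc k) (reciprocal-inverse k)) public
  open CommutativeRing K hiding (zero)
  private module S = CommutativeRing (seriesRing n)

  x-affine : ∀ i → Affine (x i)
  x-affine i j with j Fin.≟ i
  ... | yes ≡.refl = λ k → S.trans (∂-cong k (∂-x-same i)) (∂-1 k)
  ... | no j≢i     = λ k → S.trans (∂-cong k (∂-x-distinct j i j≢i)) (∂-0 k)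

  x-symmetric : Symmetric x
  x-symmetric i j with i Fin.≟ j
  ... | yes ≡.refl = S.refl
  ... | no i≢j     = S.trans (∂-x-distinct i j i≢j) (S.sym (∂-x-distinct j i (i≢j ∘ ≡.sym)))

  D-x : ∀ V i → D V (x i) S.≈ V i
  D-x V i = S.trans (select i λ j j≢i → S.trans (S.*-congˡ {V j} (∂-x-distinct j i j≢i)) (S.zeroʳ (V j)))
    (S.trans (S.*-congˡ {V i} (∂-x-same i)) (S.*-identityʳ (V i)))
    where
    select : ∀ {m} {t : Fin m → Series n} i → (∀ j → j ≢ i → t j S.≈ 0ˢ) → sumˢ t S.≈ t i
    select {suc m} {t} zero t≈0 = S.trans (S.+-congˡ {t zero} (all-zero m λ j → t≈0 (suc j) λ ())) (S.+-identityʳ (t zero))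
      where
      all-zero : ∀ m {t : Fin m → Series n} → (∀ j → t j S.≈ 0ˢ) → sumˢ t S.≈ 0ˢ
      all-zero zero    t≈0 = S.refl
      all-zero (suc m) t≈0 = S.trans (S.+-cong (t≈0 zero) (all-zero m (t≈0 ∘ suc))) (S.+-identityʳ 0ˢ)
    select {suc m} {t} (suc i) t≈0 = S.trans
      (S.+-cong (t≈0 zero λ ()) (select i λ j j≢i → t≈0 (suc j) (j≢i ∘ Fin.suc-injective)))
      (S.+-identityˡ (t (suc i)))

  module _ (V U : Vector) (U≈x+V : ∀ i → U i S.≈ x i +ˢ V i) where

    taylorSum-^ : ∀ i a {f s} → HasTaylorSum V f s → HasTaylorSum V ((x i ^ˢ a) *ˢ f) ((U i ^ˢ a) *ˢ s)
    taylorSum-^ i zero    {f} {s} T = taylorSum-cong V {f} {_} {s} (S.sym (S.*-identityˡ f)) (S.sym (S.*-identityˡ s)) T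
    taylorSum-^ i (suc a) {f} {s} T = taylorSum-cong V
      {x i *ˢ ((x i ^ˢ a) *ˢ f)} {_} {(x i +ˢ D V (x i)) *ˢ ((U i ^ˢ a) *ˢ s)}
      (S.sym (S.*-assoc (x i) (x i ^ˢ a) f))
      (S.trans (S.*-congʳ {(U i ^ˢ a) *ˢ s} (S.trans (S.+-congˡ {x i} (D-x V i)) (S.sym (U≈x+V i))))
        (S.sym (S.*-assoc (U i) (U i ^ˢ a) s)))
      (taylorSum-affine-* V (x-affine i) (taylorSum-^ i a T))

    -- The recursion shortens the exponent vector while the ambient number of variables stays n; `ι`
    -- records which variables remain.
    taylorSum-power : ∀ {m} (ι : Fin m → Fin n) (α : Exponent m) → HasTaylorSum V (power (x ∘ ι) α) (power (U ∘ ι) α)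
    taylorSum-power ι []      = taylorSum-constant V ∂-1
    taylorSum-power ι (a ∷ α) = taylorSum-^ (ι zero) a (taylorSum-power (ι ∘ suc) α)

    taylorSum-sum : ∀ {m} (s t : Fin m → Series n) → (∀ i → HasTaylorSum V (s i) (t i)) → HasTaylorSum V (sumˢ s) (sumˢ t)
    taylorSum-sum {zero}  s t T = taylorSum-constant V ∂-0
    taylorSum-sum {suc m} s t T = taylorSum-+ V (T zero) (taylorSum-sum (s ∘ suc) (t ∘ suc) (T ∘ suc))

    taylorSum-Σ□ : ∀ {m} (δ : Exponent m) (s t : Exponent m → Series n) → (∀ α → HasTaylorSum V (s α) (t α)) →
      HasTaylorSum V (λ γ → Σ□ δ λ α → s α γ) (λ γ → Σ□ δ λ α → t α γ)
    taylorSum-Σ□ []      s t T = T []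
    taylorSum-Σ□ (a ∷ δ) s t T = taylorSum-cong V
      (λ γ → reflexive (sumˢ-at {m = suc a} (λ i γ → Σ□ δ λ α → s (toℕ i ∷ α) γ) γ))
      (λ γ → reflexive (sumˢ-at {m = suc a} (λ i γ → Σ□ δ λ α → t (toℕ i ∷ α) γ) γ))
      (taylorSum-sum {suc a} _ _ λ i → taylorSum-Σ□ δ (λ α → s (toℕ i ∷ α)) (λ α → t (toℕ i ∷ α)) λ α → T (toℕ i ∷ α))

    -- Taylor's formula for f (X + V). After `f` is written as the sum of its monomials over the
    -- same box, both sides are sums of constants times powers, with `x` on one side and `U` on the
    -- other.
    substitute-taylorSum : ∀ E f → DegreeAtMost E f → HasTaylorSum V f (substituteUpTo E f U)
    substitute-taylorSum E f f≤E = taylorSum-cong V (substitute-x E f f≤E) (λ _ → refl)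
      (taylorSum-Σ□ (replicate n E) (λ α γ → f α * power x α γ) (λ α γ → f α * power U α γ) λ α →
        taylorSum-cong V (constant-* (f α) (power x α)) (constant-* (f α) (power U α))
          (taylorSum-constant-* V (λ i → ∂-constant i (f α)) (taylorSum-power (λ i → i) α)))

-- Inversion of X - H and comparison with the formal inverse.

module Inversion {c ℓ} {K : CommutativeRing c ℓ} (A : ℚ-Algebra K) {n : ℕ} (e : ℕ)
  (H : PolynomialMaps.PolyMap K n)
  (homogeneous : ∀ i → PolynomialMaps.Homogeneous K (suc (suc e)) (H i))
  (symmetric : PolynomialMaps.Symmetric K (PolynomialMaps.J K H))
  (cube-zero : PolynomialMaps.IsZero K
    (PolynomialMaps._⊗_ K (PolynomialMaps._⊗_ K (PolynomialMaps.J K H) (PolynomialMaps.J K H)) (PolynomialMaps.J K H)))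
  where

  open PolynomialMaps K
  open Monomials K
  open Graded K
  open SeriesRing K using (x) renaming (seriesRing to 𝕊)
  open CommutativeRing K hiding (zero) renaming (_≈_ to _≈ᴷ_; _+_ to _+ᴷ_; _*_ to _*ᴷ_)
  open RingProperties ring using (-0#≈0#)
  private module S = CommutativeRing (𝕊 n)
  open Taylor A n using (x-symmetric; D-x; substitute-taylorSum; module NilpotentGradient)
  open NilpotentGradient x (series H) D-x x-symmetric symmetric (suc e) (λ i → euler (homogeneous i)) cube-zero

  h : SeriesMap n
  h = series H

  -- The value 2d - 1 arises as d + (d - 1), from `h j` times a derivative of `h i`; it is also 2(d
  -- - 1) + 1, the degree of N⁽²⁾. Writing d as e + 2 lets the truncated subtractions compute.
  d degree-b : ℕ
  d = suc (suc e)
  degree-b = 2 ℕ.* d ∸ 1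

  b-homogeneous : ∀ i → HomogeneousOf degree-b (b i)
  b-homogeneous i α α≢ = sum-homogeneous (λ j → h j * ∂ j (h i))
    (λ j → *-homogeneous (homogeneous j) (∂-homogeneous j (homogeneous i))) α (α≢ ∘ λ eq → ≡.trans eq (lemma e))
    where
    lemma : ∀ e → suc (suc e) ℕ.+ suc e ≡ suc (e ℕ.+ (suc (suc e) ℕ.+ 0))
    lemma = solve-∀

  d<degree-b : d < degree-b
  d<degree-b = s≤s (≡.subst (_≤ e ℕ.+ (d ℕ.+ 0)) (ℕ.+-identityʳ d) (ℕ.m≤n+m (d ℕ.+ 0) e))

  g-degree : ∀ i → DegreeAtMost degree-b (g i)
  g-degree i α b<α = trans (+-cong (trans (+-cong
      (x-homogeneous i α (ℕ.>⇒≢ (ℕ.<-trans (s≤s (s≤s z≤n)) d<α)))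
      (homogeneous i α (ℕ.>⇒≢ d<α))) (+-identityʳ 0#))
      (b-homogeneous i α (ℕ.>⇒≢ b<α))) (+-identityʳ 0#)
    where
    d<α : d < degree α
    d<α = ℕ.<-trans d<degree-b b<α

  F F⁻¹ : PolyMap n
  F i   = X i ⊟ H i
  F⁻¹ i = record { coeff = g i ; bound = degree-b ; bounded = g-degree i }

  F∘F⁻¹≋X : F ∘ᴾ g ≋ series X
  F∘F⁻¹≋X i = f∘g (substitute-taylorSum h+b g (λ j → S.+-assoc (x j) (h j) (b j)) (bound (F i)) (f i) (bounded (F i)))

  F⁻¹∘F≋X : F⁻¹ ∘ᴾ series F ≋ series X
  F⁻¹∘F≋X i = g∘f (substitute-taylorSum -h f (λ j → S.refl) degree-b (g i) (g-degree i))

  x-vanishes : ∀ (i : Fin n) → VanishesBelow 1 (x i)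
  x-vanishes i α α<1 = x-homogeneous i α (ℕ.<⇒≢ α<1)

  g-vanishes : ∀ i → VanishesBelow 1 (g i)
  g-vanishes i α α<1 = trans (+-cong (trans (+-cong
      (x-vanishes i α α<1)
      (homogeneous i α (ℕ.<⇒≢ α<d))) (+-identityʳ 0#))
      (b-homogeneous i α (ℕ.<⇒≢ (ℕ.<-trans α<d d<degree-b)))) (+-identityʳ 0#)
    where
    α<d : degree α < d
    α<d = ℕ.<-≤-trans α<1 (s≤s z≤n)

  -- Both `g` and `G` are right inverses of `F` without constant term; for `G` the latter comes from
  -- `leading`. The perturbation of X in `F` is `-h`.
  formalInverse-unique : ∀ G → IsFormalInverse F G → series F⁻¹ ≋ G
  formalInverse-unique G inv = rightInverse-unique (s≤s (s≤s z≤n)) -h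
    (λ i α α≢d → trans (-‿cong (homogeneous i α α≢d)) -0#≈0#)
    (bound ∘ F) (λ i → ℕ.m≤m⊔n 1 (bound (H i))) g G g-vanishes
    (λ i α α<1 → trans (leading i α (ℕ.<⇒≤ α<1)) (x-vanishes i α α<1))
    (λ i γ → trans (F∘F⁻¹≋X i γ) (sym (F∘G≋X i γ)))
    where open IsFormalInverse inv

  ≈-component : ∀ k (s : Series n) α {y} → (degree α ≡ k → y ≈ᴷ s α) → (degree α ≢ k → y ≈ᴷ 0#) →
    y ≈ᴷ coeff (component k s) α
  ≈-component k s α in-degree off-degree with degree α ℕ.≟ k
  ... | yes α≡k = trans (in-degree α≡k) (reflexive (≡.cong (if_then s α else 0#) (≡.sym (dec-true (degree α ℕ.≟ k) α≡k))))
  ... | no α≢k  = trans (off-degree α≢k) (reflexive (≡.cong (if_then s α else 0#) (≡.sym (dec-false (degree α ℕ.≟ k) α≢k))))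

  -- By uniqueness `g` and `G` have the same coefficients. In degree d only the summand `h` of `g`
  -- survives, in degree 2d - 1 only `b`, so these are the components of `G` that define N⁽¹⁾ and
  -- N⁽²⁾.
  F⁻¹≋X+N₁+N₂ : ∀ G → IsFormalInverse F G → series F⁻¹ ≋ series (λ i → X i ⊞ N d G 1 i ⊞ N d G 2 i)
  F⁻¹≋X+N₁+N₂ G inv i α = +-cong (+-congˡ (h≈N₁)) b≈N₂
    where
    g≈G : g i α ≈ᴷ G i α
    g≈G = formalInverse-unique G inv i α
    d≡ : 1 ℕ.* (d ∸ 1) ℕ.+ 1 ≡ d
    d≡ = eq e
      where
      eq : ∀ e → 1 ℕ.* suc e ℕ.+ 1 ≡ suc (suc e)
      eq = solve-∀
    b≡ : 2 ℕ.* (d ∸ 1) ℕ.+ 1 ≡ degree-b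
    b≡ = eq e
      where
      eq : ∀ e → 2 ℕ.* suc e ℕ.+ 1 ≡ suc (e ℕ.+ (suc (suc e) ℕ.+ 0))
      eq = solve-∀
    1<α : d ≤ degree α → x i α ≈ᴷ 0#
    1<α d≤α = x-homogeneous i α (ℕ.>⇒≢ (ℕ.<-≤-trans (s≤s (s≤s z≤n)) d≤α))
    h≈N₁ : h i α ≈ᴷ coeff (N d G 1 i) α
    h≈N₁ = ≈-component _ (G i) α in-degree λ α≢ → homogeneous i α (α≢ ∘ λ eq → ≡.trans eq (≡.sym d≡))
      where
      in-degree : degree α ≡ 1 ℕ.* (d ∸ 1) ℕ.+ 1 → h i α ≈ᴷ G i α
      in-degree α≡ = trans (sym (trans (+-cong (trans (+-congʳ (1<α (ℕ.≤-reflexive (≡.sym α≡d)))) (+-identityˡ _))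
        (b-homogeneous i α (ℕ.<⇒≢ (≡.subst (_< degree-b) (≡.sym α≡d) d<degree-b)))) (+-identityʳ _))) g≈G
        where
        α≡d : degree α ≡ d
        α≡d = ≡.trans α≡ d≡
    b≈N₂ : b i α ≈ᴷ coeff (N d G 2 i) α
    b≈N₂ = ≈-component _ (G i) α in-degree λ α≢ → b-homogeneous i α (α≢ ∘ λ eq → ≡.trans eq (≡.sym b≡))
      where
      in-degree : degree α ≡ 2 ℕ.* (d ∸ 1) ℕ.+ 1 → b i α ≈ᴷ G i α
      in-degree α≡ = trans (sym (trans (+-congʳ (trans (+-cong (1<α (ℕ.<⇒≤ d<α))
        (homogeneous i α (ℕ.>⇒≢ d<α))) (+-identityʳ 0#))) (+-identityˡ _))) g≈G
        where
        d<α : d < degree α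
        d<α = ≡.subst (d <_) (≡.sym (≡.trans α≡ b≡)) d<degree-b

theorem3p2 :
    ∀ {c ℓ} (K : CommutativeRing c ℓ) → ℚ-Algebra K →
    let open PolynomialMaps K in
    (n : ℕ) → 1 ≤ n →
    (d : ℕ) → 2 ≤ d →
    (H : PolyMap n) →
    (∀ i → Homogeneous d (H i)) →
    Symmetric (J H) →
    IsZero (J H ⊗ J H ⊗ J H) →
    let F : PolyMap n
        F i = X i ⊟ H i
    in
    Σ[ F⁻¹ ∈ PolyMap n ]
      IsInverse F F⁻¹
      × (∀ (G : SeriesMap n) → IsFormalInverse F G →
           series F⁻¹ ≋ series (λ i → X i ⊞ N d G 1 i ⊞ N d G 2 i))
      × (∀ i → DegreeAtMost (2 ℕ.* d ∸ 1) (coeff (F⁻¹ i)))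
theorem3p2 K A n _ (suc (suc e)) (s≤s (s≤s z≤n)) H homogeneous symmetric cube-zero =
  F⁻¹ , (F∘F⁻¹≋X , F⁻¹∘F≋X) , F⁻¹≋X+N₁+N₂ , g-degree
  where open Inversion A e H homogeneous symmetric cube-zero
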